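{- Let $G=(V,E)$ be a simple graph with $n$ vertices, $m$ edges and maximum degree $\Delta$. (1) (Deterministic trade-off) Let $\frac{1}{\Delta}\leq\varepsilon<1$. The deterministic variant of Procedure Edge-Coloring with parameter $h=\max\{\lfloor\log(\varepsilon\Delta/3)\rfloor,0\}$ computes a proper edge-coloring of $G$ using at most $(1+\varepsilon)\Delta$ colors in $O\left(\frac{m\log n}{\varepsilon}\right)$ time. (2) (Randomized trade-off) Let $\max\{\frac{\log\log n}{\log n},\frac{1}{\Delta}\}\leq\varepsilon<1$ and let $c>0$ be an arbitrary constant determining the threshold $\tau=(c+1)\log n$. The randomized variant of Procedure Edge-Coloring with parameter $h=\max\{\lfloor\log(\varepsilon\Delta/4)\rfloor,0\}$ computes a proper edge-coloring of $G$ using at most $(1+\varepsilon)\Delta$ colors in $O\left(m\varepsilon^{ -18}+m\log(\varepsilon\Delta)\right)$ time, with probability at least $1-\frac{1}{n^{c}}$.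
   Context: All logarithms are base 2. A proper $k$-edge-coloring of $G$ is a map $\varphi:E\to\{1,\dots,k\}$ with $\varphi(e)\neq\varphi(e')$ for distinct edges sharing an endpoint. A degree-splitting of $G$ with discrepancy $\kappa$ is a partition $(E_1,E_2)$ of $E$ such that for every vertex $v$, $|\deg_{E_1}(v)-\deg_{E_2}(v)|\le\kappa$. Procedure Edge-Coloring$(G,h)$, for an integer $h\ge 0$: if $h=0$, return a proper $(\Delta(G)+1)$-edge-coloring of $G$ computed by a base-case subroutine (palette $\{1,\dots,\Delta(G)+1\}$). Otherwise compute a degree-splitting $(E_1,E_2)$ of $G$ with discrepancy at most 2 and with $\{|E_1|,|E_2|\}=\{\lfloor |E|/2\rfloor,\lceil |E|/2\rceil\}$ (computable in $O(|E|)$ time); let $G_1=(V,E_1)$, $G_2=(V,E_2)$ with isolated vertices discarded; recursively compute $\varphi_1=$ Edge-Coloring$(G_1,h-1)$ and $\varphi_2=$ Edge-Coloring$(G_2,h-1)$; return $\varphi(e)=\varphi_1(e)$ for $e\in E_1$ and $\varphi(e)=p_1+\varphi_2(e)$ for $e\in E_2$, where $p_1$ is the palette size of $\varphi_1$ (palette sizes add up along the recursion). Deterministic variant: the base-case subroutine is a deterministic algorithm that computes a proper $(\Delta'+1)$-edge-coloring of a graph with $n'$ vertices, $m'$ edges and maximum degree $\Delta'$ in $O(m'\Delta'\log n')$ time. Randomized variant: in the base case, with input having $n'$ vertices, $m'$ edges, maximum degree $\Delta'$: if $n'\ge\tau=(c+1)\log n$ (with $n$ the number of vertices of the original input), use a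 randomized algorithm that outputs a proper $(\Delta'+1)$-edge-coloring in $O(\Delta'^{18}n')$ time with probability at least $1-\Delta'^{ -n'}$; otherwise use the deterministic base algorithm above.
   Formalization: Part (2) assumes that G has no isolated vertices; as stated it fails, e.g. for a 2-edge path plus many isolated vertices with ε = 1/2, where h = 0 and the randomized base case may take time of order Δ^18·n while the claimed bound is constant. -}

module Defs where

open import Algebra.Bundles using (CommutativeRing; Semiring)
import Algebra.Definitions.RawSemiring as RawSemiringDefinitions
open import Data.Bool.Base using (Bool; true; false; if_then_else_)
import Data.Bool.Properties as Bool
open import Data.Fin.Base as Fin using (Fin)
import Data.Fin.Properties as Fin
open import Data.Fin.Subset using (Subset; _∈_; ∣_∣)
open import Data.Integer.Base as ℤ using (ℤ; +_; -[1+_])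
open import Data.List.Base using (List; []; _∷_; _++_; map; filter; length; concatMap; foldr; allFin)
open import Data.List.Extrema.Nat using (max)
open import Data.List.Membership.Propositional renaming (_∈_ to _∈ˡ_) using (lose)
open import Data.List.Properties using (filter-some)
open import Data.List.Relation.Unary.All as All using (All; []; _∷_)
import Data.List.Relation.Unary.All.Properties as All
open import Data.List.Relation.Unary.Unique.Propositional using (Unique)
import Data.List.Relation.Unary.Unique.Propositional.Properties as Unique
open import Data.Nat.Base as ℕ using (ℕ; suc; ⌊_/2⌋; ⌈_/2⌉)
import Data.Nat.Properties as ℕ
open import Data.Product.Base using (∃; _×_; _,_; proj₁; proj₂)
open import Data.Sum.Base using (_⊎_; inj₁; inj₂)
open import Data.Vec.Base using (tabulate)
open import Data.Vec.Properties using (lookup⇒[]=; lookup∘tabulate)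
open import Effect.Monad using (RawMonad; mkRawMonad)
open import Effect.Monad.Identity as Identity using (Identity; runIdentity)
open import Function.Base using (_∘_)
open import Level using (0ℓ)
open import Relation.Binary.Core using (Rel)
open import Relation.Binary.Definitions using (DecidableEquality)
open import Relation.Binary.Structures using (IsDecTotalOrder)
open import Relation.Binary.PropositionalEquality using (_≡_; _≢_; refl; trans)
open import Relation.Nullary using (does; ¬_)
open import Relation.Nullary.Decidable using (_×-dec_; _⊎-dec_; _→-dec_; ¬?; dec-true; map′)
open import Relation.Unary using (Decidable)

module Embedding (R : CommutativeRing 0ℓ 0ℓ) where
  open CommutativeRing R using (semiring; 1#; -_) renaming (Carrier to A)
  private module Def = RawSemiringDefinitions (Semiring.rawSemiring semiring)

  fromℕ : ℕ → A
  fromℕ n = n Def.× 1#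

  fromℤ : ℤ → A
  fromℤ (+ n)    = fromℕ n
  fromℤ -[1+ n ] = - fromℕ (suc n)

-- A complete ordered field, with binary exponential and logarithm.  The
-- library has no real numbers; the axioms below determine them (classically)
-- up to isomorphism, and determine ⌊_⌋, 2^_, and _⁻¹ and log₂ on nonzero and
-- positive arguments respectively (elsewhere these two are unconstrained).
record Reals : Set₁ where
  infix  4 _≤_ _<_
  infixl 7 _/_
  infix  8 _⁻¹
  field
    commutativeRing : CommutativeRing 0ℓ 0ℓ

  open CommutativeRing commutativeRing public
    renaming (Carrier to ℝ)
    using (_≈_; _+_; _*_; _-_; -_; 0#; 1#)
  open RawSemiringDefinitions (Semiring.rawSemiring (CommutativeRing.semiring commutativeRing)) public
    using (_^_)
  open Embedding commutativeRing public

  field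
    _≤_             : Rel ℝ 0ℓ
    isDecTotalOrder : IsDecTotalOrder _≈_ _≤_

  _<_ : Rel ℝ 0ℓ
  x < y = x ≤ y × ¬ (x ≈ y)

  field
    0≉1         : ¬ (0# ≈ 1#)
    +-monoʳ-≤   : ∀ z {x y} → x ≤ y → z + x ≤ z + y
    *-nonneg    : ∀ {x y} → 0# ≤ x → 0# ≤ y → 0# ≤ x * y
    _⁻¹         : ℝ → ℝ
    *-inverseʳ  : ∀ {x} → ¬ (x ≈ 0#) → x * x ⁻¹ ≈ 1#

  IsUpperBound : (ℝ → Set) → ℝ → Set
  IsUpperBound P b = ∀ x → P x → x ≤ b

  field
    supremum : (P : ℝ → Set) → ∃ P → ∃ (IsUpperBound P) →
               ∃ λ s → IsUpperBound P s × (∀ b → IsUpperBound P b → s ≤ b)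

    ⌊_⌋      : ℝ → ℤ
    ⌊⌋-lower : ∀ x → fromℤ ⌊ x ⌋ ≤ x
    ⌊⌋-upper : ∀ x → x < fromℤ ⌊ x ⌋ + 1#

    2^_      : ℝ → ℝ
    2^-mono  : ∀ {x y} → x ≤ y → 2^ x ≤ 2^ y
    2^-+     : ∀ x y → 2^ (x + y) ≈ 2^ x * 2^ y
    2^-1     : 2^ 1# ≈ 1# + 1#
    log₂     : ℝ → ℝ
    log-mono : ∀ {x y} → 0# < x → x ≤ y → log₂ x ≤ log₂ y
    2^-log   : ∀ {x} → 0# < x → 2^ (log₂ x) ≈ x
    log-2^   : ∀ x → log₂ (2^ x) ≈ x

  open IsDecTotalOrder isDecTotalOrder public using (_≤?_)

  _/_ : ℝ → ℝ → ℝ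
  x / y = x * y ⁻¹

  _^ʳ_ : ℝ → ℝ → ℝ
  x ^ʳ y = 2^ (y * log₂ x)

-- An edge {lo, hi}, stored with its endpoints in increasing order so that each
-- unordered pair has exactly one representation and there are no loops.
record Edge (N : ℕ) : Set where
  constructor edge
  field
    lo hi  : Fin N
    .lo<hi : lo Fin.< hi
open Edge public

infix 4 _≟ᴱ_
_≟ᴱ_ : ∀ {N} → DecidableEquality (Edge N)
edge u v _ ≟ᴱ edge u′ v′ _ = map′ (λ { (refl , refl) → refl }) (λ { refl → refl , refl })
                                  (u Fin.≟ u′ ×-dec v Fin.≟ v′)

Incident : ∀ {N} → Fin N → Edge N → Set
Incident v e = v ≡ lo e ⊎ v ≡ hi e

incident? : ∀ {N} (v : Fin N) → Decidable (Incident v)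
incident? v e = v Fin.≟ lo e ⊎-dec v Fin.≟ hi e

degree : ∀ {N} → List (Edge N) → Fin N → ℕ
degree E v = length (filter (incident? v) E)

-- A finite simple graph (V , E) whose vertex set is a subset of Fin N.  The
-- ambient Fin N only supplies names, so that passing to a subgraph and
-- discarding isolated vertices needs no relabelling.
record Graph (N : ℕ) : Set where
  field
    vertices  : Subset N
    edges     : List (Edge N)
    unique    : Unique edges
    endpoints : All (λ e → lo e ∈ vertices × hi e ∈ vertices) edges
open Graph public

order size maxDegree : ∀ {N} → Graph N → ℕ
order G     = ∣ vertices G ∣
size G      = length (edges G)
-- Names outside the vertex set have degree 0.
maxDegree G = max 0 (map (degree (edges G)) (allFin _))

NoIsolatedVertices : ∀ {N} → Graph N → Set
NoIsolatedVertices G = ∀ v → v ∈ vertices G → 1 ℕ.≤ degree (edges G) v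

covered : ∀ {N} → List (Edge N) → Subset N
covered E = tabulate λ v → does (1 ℕ.≤? degree E v)

∈-covered : ∀ {N} {E : List (Edge N)} {e v} → e ∈ˡ E → Incident v e → v ∈ covered E
∈-covered {E = E} {v = v} e∈E inc =
  lookup⇒[]= v _ (trans (lookup∘tabulate _ v)
    (dec-true (1 ℕ.≤? degree E v) (filter-some (incident? v) (lose e∈E inc))))

subgraph : ∀ {N} {P : Edge N → Set} → Decidable P → Graph N → Graph N
subgraph P? G = record
  { vertices  = covered E′
  ; edges     = E′
  ; unique    = Unique.filter⁺ P? (unique G)
  ; endpoints = All.tabulate λ e∈E′ → ∈-covered e∈E′ (inj₁ refl) , ∈-covered e∈E′ (inj₂ refl)
  }
  where E′ = filter P? (edges G)

SharesEndpoint : ∀ {N} → Edge N → Edge N → Set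
SharesEndpoint e e′ = ∃ λ v → Incident v e × Incident v e′

IsProperColoring : ∀ {N} → Graph N → ℕ → (Edge N → ℕ) → Set
IsProperColoring G k φ =
  All (λ e → 1 ℕ.≤ φ e × φ e ℕ.≤ k) (edges G) ×
  All (λ e → All (λ e′ → e ≢ e′ → SharesEndpoint e e′ → φ e ≢ φ e′) (edges G)) (edges G)

isProperColoring? : ∀ {N} (G : Graph N) k → Decidable (IsProperColoring G k)
isProperColoring? G k φ =
  All.all? (λ e → 1 ℕ.≤? φ e ×-dec φ e ℕ.≤? k) (edges G) ×-dec
  All.all? (λ e → All.all? (λ e′ →
    ¬? (e ≟ᴱ e′) →-dec
    Fin.any? (λ v → incident? v e ×-dec incident? v e′) →-dec
    ¬? (φ e ℕ.≟ φ e′)) (edges G)) (edges G)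

-- A partition (E₁ , E₂) of the edge set is given by its indicator: E₁ is where
-- it is true, E₂ where it is false.
module _ {N} (G : Graph N) (side : Edge N → Bool) where

  part : Bool → Graph N
  part b = subgraph (λ e → side e Bool.≟ b) G

  IsDegreeSplitting : ℕ → Set
  IsDegreeSplitting κ = ∀ v → v ∈ vertices G →
    ℕ.∣ degree (edges (part true)) v - degree (edges (part false)) v ∣ ℕ.≤ κ

  IsBalanced : Set
  IsBalanced =
    (size (part true) ≡ ⌊ size G /2⌋ × size (part false) ≡ ⌈ size G /2⌉) ⊎
    (size (part true) ≡ ⌈ size G /2⌉ × size (part false) ≡ ⌊ size G /2⌋)

-- f(G) = O(|E|).  As in the other time bounds below, graphs without edges are
-- exempt, which only weakens what is assumed of the subroutines.
LinearTime : (∀ {N} → Graph N → ℕ) → Set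
LinearTime f = ∃ λ C → ∀ {N} (G : Graph N) → 1 ℕ.≤ size G → f G ℕ.≤ C ℕ.* size G

-- Running times are natural numbers of elementary steps, returned together
-- with the result.  `overhead` is the time a call of the procedure spends
-- outside its subroutine and recursive calls (forming the two subgraphs and
-- merging their colorings).
record Implementation : Set where
  field
    split           : ∀ {N} → Graph N → (Edge N → Bool) × ℕ
    split-degrees   : ∀ {N} (G : Graph N) → IsDegreeSplitting G (proj₁ (split G)) 2
    split-balanced  : ∀ {N} (G : Graph N) → IsBalanced G (proj₁ (split G))
    split-linear    : LinearTime (λ G → proj₂ (split G))
    overhead        : ∀ {N} → Graph N → ℕ
    overhead-linear : LinearTime overhead

record Coloring (N : ℕ) : Set where
  field
    palette : ℕ
    color   : Edge N → ℕ
open Coloring public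

merge : ∀ {N} → (Edge N → Bool) → Coloring N → Coloring N → Coloring N
merge side φ₁ φ₂ = record
  { palette = palette φ₁ ℕ.+ palette φ₂
  ; color   = λ e → if side e then color φ₁ e else palette φ₁ ℕ.+ color φ₂ e
  }

-- Procedure Edge-Coloring, over the monad of effects of its base case:
-- Identity for the deterministic variant, Distribution for the randomized one.
-- The palette of a base case is {1 , … , Δ + 1} whatever the subroutine returns.
module Procedure (impl : Implementation) {M : Set → Set} (monad : RawMonad M)
                 (base : ∀ {N} → Graph N → M ((Edge N → ℕ) × ℕ)) where
  open Implementation impl
  open RawMonad monad

  edgeColoring : ∀ {N} → ℕ → Graph N → M (Coloring N × ℕ)
  edgeColoring 0 G = do
    (f , t) ← base G
    pure (record { palette = suc (maxDegree G) ; color = f } , overhead G ℕ.+ t)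
  edgeColoring (suc h) G = do
    let (side , t) = split G
    (φ₁ , t₁) ← edgeColoring h (part G side true)
    (φ₂ , t₂) ← edgeColoring h (part G side false)
    pure (merge side φ₁ φ₂ , overhead G ℕ.+ t ℕ.+ t₁ ℕ.+ t₂)

module Probability (ℛ : Reals) where
  open Reals ℛ
  private
    module CR = CommutativeRing (Reals.commutativeRing ℛ)
    module O  = IsDecTotalOrder isDecTotalOrder
    open import Relation.Binary.Reasoning.Setoid CR.setoid

  mass : {A : Set} → List (ℝ × A) → ℝ
  mass = foldr (λ wa s → proj₁ wa + s) 0#

  -- Finitely supported probability distributions; outcomes may be repeated.
  record Distribution (A : Set) : Set where
    field
      outcomes : List (ℝ × A)
      nonneg   : All (λ wa → 0# ≤ proj₁ wa) outcomes
      total    : mass outcomes ≈ 1#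
  open Distribution public

  scale : {A : Set} → ℝ → List (ℝ × A) → List (ℝ × A)
  scale w = map λ va → w * proj₁ va , proj₂ va

  mass-++ : ∀ {A : Set} (xs ys : List (ℝ × A)) → mass (xs ++ ys) ≈ mass xs + mass ys
  mass-++ []             ys = CR.sym (CR.+-identityˡ _)
  mass-++ ((w , _) ∷ xs) ys = CR.trans (CR.+-congˡ (mass-++ xs ys)) (CR.sym (CR.+-assoc _ _ _))

  mass-scale : ∀ {A : Set} w (xs : List (ℝ × A)) → mass (scale w xs) ≈ w * mass xs
  mass-scale w []             = CR.sym (CR.zeroʳ w)
  mass-scale w ((v , _) ∷ xs) = CR.trans (CR.+-congˡ (mass-scale w xs)) (CR.sym (CR.distribˡ w v _))

  return : {A : Set} → A → Distribution A
  return a = record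
    { outcomes = (1# , a) ∷ []
    ; nonneg   = 0≤1 ∷ []
    ; total    = CR.+-identityʳ 1#
    }
    where
    open import Algebra.Properties.Ring CR.ring using (-1*x≈-x; -‿involutive)

    0≤1 : 0# ≤ 1#
    0≤1 with O.total 0# 1#
    ... | inj₁ 0≤1 = 0≤1
    ... | inj₂ 1≤0 = O.≤-respʳ-≈ (CR.trans (-1*x≈-x (- 1#)) (-‿involutive 1#)) (*-nonneg 0≤-1 0≤-1)
      where
      0≤-1 : 0# ≤ - 1#
      0≤-1 = O.≤-respˡ-≈ (CR.-‿inverseˡ 1#) (O.≤-respʳ-≈ (CR.+-identityʳ (- 1#)) (+-monoʳ-≤ (- 1#) 1≤0))

  bind : {A B : Set} → Distribution A → (A → Distribution B) → Distribution B
  bind {A} {B} d f = record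
    { outcomes = concatMap step (outcomes d)
    ; nonneg   = All.concat⁺ (All.map⁺ (All.map
                   (λ 0≤w → All.map⁺ (All.map (*-nonneg 0≤w) (nonneg (f _)))) (nonneg d)))
    ; total    = CR.trans (mass-concat (outcomes d)) (total d)
    }
    where
    step : ℝ × A → List (ℝ × B)
    step (w , a) = scale w (outcomes (f a))

    mass-concat : ∀ xs → mass (concatMap step xs) ≈ mass xs
    mass-concat []             = CR.refl
    mass-concat ((w , a) ∷ xs) = begin
      mass (step (w , a) ++ concatMap step xs)        ≈⟨ mass-++ (step (w , a)) _ ⟩
      mass (step (w , a)) + mass (concatMap step xs)  ≈⟨ CR.+-cong (mass-scale w (outcomes (f a))) (mass-concat xs) ⟩
      w * mass (outcomes (f a)) + mass xs             ≈⟨ CR.+-congʳ (CR.*-congˡ (total (f a))) ⟩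
      w * 1# + mass xs                                ≈⟨ CR.+-congʳ (CR.*-identityʳ w) ⟩
      w + mass xs                                     ∎

  monad : RawMonad Distribution
  monad = mkRawMonad Distribution return bind

  Pr : {A : Set} {P : A → Set} → Decidable P → Distribution A → ℝ
  Pr P? d = mass (filter (P? ∘ proj₂) (outcomes d))

module EdgeColoring (ℛ : Reals) where
  open Reals ℛ
  open Probability ℛ

  -- The constants hidden in O(·) precede the graph, hence are uniform in it.
  record DeterministicBase : Set where
    field
      run    : ∀ {N} → Graph N → (Edge N → ℕ) × ℕ
      proper : ∀ {N} (G : Graph N) → IsProperColoring G (suc (maxDegree G)) (proj₁ (run G))
      time   : ∃ λ C → ∀ {N} (G : Graph N) → 1 ℕ.≤ size G →
               fromℕ (proj₂ (run G)) ≤ C * (fromℕ (size G) * fromℕ (maxDegree G) * log₂ (fromℕ (order G)))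

  WithinTime : ∀ {N} → Graph N → ℝ → (Edge N → ℕ) × ℕ → Set
  WithinTime G T (f , t) = IsProperColoring G (suc (maxDegree G)) f × fromℕ t ≤ T

  withinTime? : ∀ {N} (G : Graph N) T → Decidable (WithinTime G T)
  withinTime? G T (f , t) = isProperColoring? G (suc (maxDegree G)) f ×-dec fromℕ t ≤? T

  record RandomizedBase : Set where
    field
      run       : ∀ {N} → Graph N → Distribution ((Edge N → ℕ) × ℕ)
      guarantee : ∃ λ C → ∀ {N} (G : Graph N) → 1 ℕ.≤ size G →
        1# - 1# / (fromℕ (maxDegree G) ^ order G) ≤
        Pr (withinTime? G (C * (fromℕ (maxDegree G) ^ 18 * fromℕ (order G)))) (run G)

  deterministicEdgeColoring : Implementation → DeterministicBase →
                              ∀ {N} → ℕ → Graph N → Coloring N × ℕ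
  deterministicEdgeColoring impl det h G =
    runIdentity (Procedure.edgeColoring impl Identity.monad
      (λ G′ → Identity.mkIdentity (DeterministicBase.run det G′)) h G)

  randomizedBase : DeterministicBase → RandomizedBase → (τ : ℝ) →
                   ∀ {N} → Graph N → Distribution ((Edge N → ℕ) × ℕ)
  randomizedBase det rnd τ G =
    if does (τ ≤? fromℕ (order G)) then RandomizedBase.run rnd G
                                   else return (DeterministicBase.run det G)

  randomizedEdgeColoring : Implementation → DeterministicBase → RandomizedBase → (c : ℝ) →
                           ∀ {N} → ℕ → Graph N → Distribution (Coloring N × ℕ)
  randomizedEdgeColoring impl det rnd c h G =
    Procedure.edgeColoring impl monad (randomizedBase det rnd τ) h G
    where τ = (c + 1#) * log₂ (fromℕ (order G))

  -- max {⌊ log x ⌋ , 0}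
  depth : ℝ → ℕ
  depth x = ℤ.∣ ⌊ log₂ x ⌋ ℤ.⊔ + 0 ∣

  ColorsWithin : ∀ {N} → Graph N → (colors time : ℝ) → Coloring N × ℕ → Set
  ColorsWithin G k T (φ , t) =
    IsProperColoring G (palette φ) (color φ) × fromℕ (palette φ) ≤ k × fromℕ t ≤ T

  colorsWithin? : ∀ {N} (G : Graph N) k T → Decidable (ColorsWithin G k T)
  colorsWithin? G k T (φ , t) =
    isProperColoring? G (palette φ) (color φ) ×-dec fromℕ (palette φ) ≤? k ×-dec fromℕ t ≤? T

{-# OPTIONS --safe #-}

-- A splitting of discrepancy 2 sends the maximum degree Δ to at most Δ/2 + 1 and
-- at least Δ/2 - 1.  So after h rounds the leaves have maximum degree at most
-- Δ/2^h + 2, and at least q - 2 as soon as q 2^h ≤ Δ + 2; the palettes add up to at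
-- most Δ + 3·2^h - 2, and a leaf time of A per edge gives total time A + O(h) per
-- edge.  The choice of h makes 3·2^h ≤ εΔ (or h = 0) and every leaf degree O(1/ε).
--
-- For the randomized variant, a randomized leaf has maximum degree at least 2 and
-- at least (c+1) log n vertices, so it fails with probability at most n^-(c+1), and
-- there are 2^h ≤ n leaves.  A deterministic leaf with ν < (c+1) log n vertices
-- must satisfy n ≤ 4·2^h ν², because the edges are split evenly; this bounds
-- (log ν)² by O(1 + h), which pays for its running time.

module Submission where

open import Algebra.Bundles using (CommutativeRing)
import Algebra.Properties.CommutativeMonoid.Sum
import Algebra.Properties.Semiring.Mult
import Algebra.Solver.Ring.NaturalCoefficients.Default
open import Data.Bool.Base using (Bool; true; false; not; if_then_else_)
import Data.Bool.Properties as Bool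
open import Data.Empty using (⊥-elim; ⊥-elim-irr)
open import Data.Fin.Base as Fin using (Fin; zero; suc)
import Data.Fin.Properties as Fin
open import Data.Fin.Subset using (Subset; inside; outside; _∈_; _∉_; ∣_∣) renaming (_-_ to _∖_)
open import Data.Fin.Subset.Properties using (_∈?_; p⊆q⇒∣p∣≤∣q∣; x∈p⇒∣p-x∣<∣p∣; x∈p∧x≢y⇒x∈p-y)
open import Data.Integer.Base using (+_; -[1+_])
open import Data.List.Base using (List; []; _∷_; _++_; allFin; concatMap; filter; length)
open import Data.List.Extrema.Nat using (xs≤max; max≤v⁺)
open import Data.List.Membership.Propositional using () renaming (_∈_ to _∈ˡ_)
open import Data.List.Membership.Propositional.Properties using (∈-allFin; ∈-filter⁻; ∈-filter⁺)
open import Data.List.Properties using (filter-++; filter-accept; filter-reject; length-filter)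
open import Data.List.Relation.Unary.All as All using (All; []; _∷_)
import Data.List.Relation.Unary.All.Properties as All
open import Data.List.Relation.Unary.AllPairs using ([]; _∷_)
open import Data.List.Relation.Unary.Any using (here; there)
open import Data.List.Relation.Unary.Unique.Propositional using (Unique)
open import Data.Nat.Base as ℕ using (ℕ; zero; suc; z≤n; s≤s; ⌊_/2⌋; ⌈_/2⌉)
import Data.Nat.Properties as ℕ
open import Data.Nat.Solver using (module +-*-Solver)
open import Data.Product.Base using (∃; _×_; _,_; proj₁; proj₂)
open import Data.Sum.Base using (_⊎_; inj₁; inj₂)
open import Data.Vec.Base using ([]; _∷_; here; there)
open import Data.Vec.Properties using ([]=⇒lookup; lookup∘tabulate)
open import Effect.Monad using (RawMonad)
open import Effect.Monad.Identity as Identity using (runIdentity)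
open import Function.Base using (_∘_)
open import Level using (0ℓ)
open import Relation.Binary.Bundles using (Poset)
open import Relation.Binary.PropositionalEquality as ≡ using (_≡_; _≢_)
import Relation.Binary.Reasoning.PartialOrder
open import Relation.Binary.Structures using (IsDecTotalOrder)
open import Relation.Nullary using (Dec; does; yes; no; ¬_; contradiction)
open import Relation.Nullary.Decidable using (_×-dec_)
open import Relation.Unary using (Decidable)
open import Defs


-- The lower bound on degrees keeps every graph of the recursion nonempty, so the running-time
-- assumptions apply to it. It also explains the two divisors in the depth: `q = 3` keeps leaf
-- degrees at least 1, while `q = 4` keeps them at least 2; at degree 1 the success probability
-- promised by the randomized subroutine would be 0.
--
-- The obstacle in the randomized part is a small leaf of degree `d`: per edge it costs `d log ν`,
-- while the target `ε^-18 + log(εΔ)` contains no `log n`. The product is split as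
-- `d log ν ≤ d² + (log ν)²`. The first square is absorbed by `ε^-18`; the second is charged to the
-- depth `H`, which is at most `log(εΔ)`. This is possible because few vertices carry few edges, so
-- a small leaf in a large input arises only after many rounds: `ν ≤ (c+1) log n` and
-- `log n ≤ 2 + H + 2 log ν` together force `ν = O(1 + H)`, with a constant depending on `c`.
--
-- Certainty and bounded failure are two instances of one interface, so a single induction over the
-- recursion serves both variants.

open Algebra.Properties.CommutativeMonoid.Sum ℕ.+-0-commutativeMonoid
  using (sum; ∑-distrib-+; sum-replicate-zero; sum-cong-≗)

-- Degrees, edge counts and vertex counts of a simple graph.

length-filter-sides : {A : Set} {P : A → Set} (P? : Decidable P) (side : A → Bool) (xs : List A) →
  length (filter P? (filter (λ x → side x Bool.≟ true) xs)) ℕ.+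
  length (filter P? (filter (λ x → side x Bool.≟ false) xs)) ≡ length (filter P? xs)
length-filter-sides P? side [] = ≡.refl
length-filter-sides P? side (x ∷ xs) with side x
... | true with does (P? x)
...   | true  = ≡.cong suc (length-filter-sides P? side xs)
...   | false = length-filter-sides P? side xs
length-filter-sides P? side (x ∷ xs) | false with does (P? x)
...   | true  = ≡.trans (ℕ.+-suc _ _) (≡.cong suc (length-filter-sides P? side xs))
...   | false = length-filter-sides P? side xs

sum≥∣S∣ : ∀ {n} (S : Subset n) (f : Fin n → ℕ) → (∀ v → v ∈ S → 1 ℕ.≤ f v) → ∣ S ∣ ℕ.≤ sum f
sum≥∣S∣ []            f h = z≤n
sum≥∣S∣ (outside ∷ S) f h = ℕ.≤-trans (sum≥∣S∣ S (f ∘ suc) (λ v v∈S → h (suc v) (there v∈S))) (ℕ.m≤n+m _ _)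
sum≥∣S∣ (inside ∷ S)  f h =
  ℕ.+-mono-≤ (h zero here) (sum≥∣S∣ S (f ∘ suc) (λ v v∈S → h (suc v) (there v∈S)))

sum≤∣S∣* : ∀ {n} (S : Subset n) (f : Fin n → ℕ) k → (∀ v → f v ℕ.≤ k) → (∀ v → v ∉ S → f v ≡ 0) →
           sum f ℕ.≤ ∣ S ∣ ℕ.* k
sum≤∣S∣* []            f k f≤k f≡0 = z≤n
sum≤∣S∣* (outside ∷ S) f k f≤k f≡0 rewrite f≡0 zero (λ ()) =
  sum≤∣S∣* S (f ∘ suc) k (f≤k ∘ suc) (λ v v∉S → f≡0 (suc v) λ { (there v∈S) → v∉S v∈S })
sum≤∣S∣* (inside ∷ S)  f k f≤k f≡0 =
  ℕ.+-mono-≤ (f≤k zero)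
    (sum≤∣S∣* S (f ∘ suc) k (f≤k ∘ suc) (λ v v∉S → f≡0 (suc v) λ { (there v∈S) → v∉S v∈S }))

indicator : ∀ {n} → Fin n → Fin n → ℕ
indicator x v = if does (v Fin.≟ x) then 1 else 0

sum-indicator : ∀ {n} (x : Fin n) → sum (indicator x) ≡ 1
sum-indicator {suc n} zero    = ≡.cong suc (sum-replicate-zero n)
sum-indicator {suc n} (suc x) = sum-indicator x

module _ {N : ℕ} where

  lo≢hi : (e : Edge N) → lo e ≢ hi e
  lo≢hi (edge u v u<v) u≡v = ⊥-elim-irr (Fin.<-irrefl u≡v u<v)

  -- A loop would make the two indicators overcount; `lo≢hi` excludes the case where both are 1.
  degree-∷ : ∀ (e : Edge N) E v →
             degree (e ∷ E) v ≡ (indicator (lo e) v ℕ.+ indicator (hi e) v) ℕ.+ degree E v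
  degree-∷ e E v with v Fin.≟ lo e | v Fin.≟ hi e
  ... | yes ≡.refl | yes v≡hi = contradiction v≡hi (lo≢hi e)
  ... | yes _    | no _     = ≡.refl
  ... | no _     | yes _    = ≡.refl
  ... | no _     | no _     = ≡.refl

  handshake : ∀ (E : List (Edge N)) → sum (degree E) ≡ 2 ℕ.* length E
  handshake []      = sum-replicate-zero N
  handshake (e ∷ E) = begin
    sum (degree (e ∷ E))
      ≡⟨ sum-cong-≗ (degree-∷ e E) ⟩
    sum (λ v → (indicator (lo e) v ℕ.+ indicator (hi e) v) ℕ.+ degree E v)
      ≡⟨ ∑-distrib-+ (λ v → indicator (lo e) v ℕ.+ indicator (hi e) v) (degree E) ⟩
    sum (λ v → indicator (lo e) v ℕ.+ indicator (hi e) v) ℕ.+ sum (degree E)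
      ≡⟨ ≡.cong₂ ℕ._+_ (∑-distrib-+ (indicator (lo e)) (indicator (hi e))) (handshake E) ⟩
    (sum (indicator (lo e)) ℕ.+ sum (indicator (hi e))) ℕ.+ 2 ℕ.* length E
      ≡⟨ ≡.cong (ℕ._+ 2 ℕ.* length E) (≡.cong₂ ℕ._+_ (sum-indicator (lo e)) (sum-indicator (hi e))) ⟩
    2 ℕ.+ 2 ℕ.* length E
      ≡⟨ ℕ.*-suc 2 (length E) ⟨
    2 ℕ.* suc (length E) ∎
    where open ≡.≡-Reasoning

  degree⇒incident : ∀ {E : List (Edge N)} {v} → 1 ℕ.≤ degree E v → ∃ λ e → e ∈ˡ E × Incident v e
  degree⇒incident {E} {v} 1≤d with filter (incident? v) E in eq
  ... | e ∷ _ = e , ∈-filter⁻ (incident? v) (≡.subst (e ∈ˡ_) (≡.sym eq) (here ≡.refl))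

  covered⇒degree : ∀ {E : List (Edge N)} {v} → v ∈ covered E → 1 ℕ.≤ degree E v
  covered⇒degree {E} {v} v∈ with 1 ℕ.≤? degree E v in eq
  ... | yes 1≤d = 1≤d
  ... | no  _ with ≡.trans (≡.sym ([]=⇒lookup v∈)) (≡.trans (lookup∘tabulate (λ u → does (1 ℕ.≤? degree E u)) v) (≡.cong does eq))
  ...   | ()

  other : Fin N → Edge N → Fin N
  other v e = if does (v Fin.≟ lo e) then hi e else lo e

  -- This is where simplicity enters. If `v` were the low end of one edge and the high end of the
  -- other, equal far ends would order the same two endpoints both ways.
  other-injective : ∀ {v e e′} → Incident v e → Incident v e′ → other v e ≡ other v e′ → e ≡ e′
  other-injective {v} {edge a b p} {edge c d q} i j o≡ with v Fin.≟ a | v Fin.≟ c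
  ... | yes ≡.refl | yes ≡.refl with o≡
  ...   | ≡.refl = ≡.refl
  other-injective {v} {edge a b p} {edge c d q} i (inj₁ v≡c) o≡ | _ | no v≢c = contradiction v≡c v≢c
  other-injective {v} {edge a b p} {edge c d q} (inj₁ v≡a) j o≡ | no v≢a | _ = contradiction v≡a v≢a
  other-injective {v} {edge a b p} {edge c d q} i (inj₂ ≡.refl) ≡.refl | yes ≡.refl | no _ = ⊥-elim-irr (Fin.<-asym p q)
  other-injective {v} {edge a b p} {edge c d q} (inj₂ ≡.refl) j ≡.refl | no _ | yes ≡.refl = ⊥-elim-irr (Fin.<-asym p q)
  other-injective {v} {edge a b p} {edge c d q} (inj₂ ≡.refl) (inj₂ ≡.refl) ≡.refl | no _ | no _ = ≡.refl

  -- Sending each edge at `v` to its far end is injective. `S` is a variable because the induction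
  -- deletes from it the far end of every edge at `v` that it passes.
  degree≤∣S∣ : ∀ (S : Subset N) v (E : List (Edge N)) → Unique E →
               (∀ e → e ∈ˡ E → Incident v e → other v e ∈ S) → degree E v ℕ.≤ ∣ S ∣
  degree≤∣S∣ S v []      _        h = z≤n
  degree≤∣S∣ S v (e ∷ E) (e∉E ∷ u) h = case-incident (incident? v e)
    where
    open ℕ.≤-Reasoning
    case-incident : Dec (Incident v e) → degree (e ∷ E) v ℕ.≤ ∣ S ∣
    case-incident (no ¬inc) = begin
      degree (e ∷ E) v  ≡⟨ ≡.cong length (filter-reject (incident? v) ¬inc) ⟩
      degree E v        ≤⟨ degree≤∣S∣ S v E u (λ e′ e′∈E → h e′ (there e′∈E)) ⟩
      ∣ S ∣             ∎
    case-incident (yes inc) = begin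
      degree (e ∷ E) v             ≡⟨ ≡.cong length (filter-accept (incident? v) inc) ⟩
      suc (degree E v)             ≤⟨ s≤s (degree≤∣S∣ (S ∖ other v e) v E u removed) ⟩
      suc ∣ S ∖ other v e ∣        ≤⟨ x∈p⇒∣p-x∣<∣p∣ (h e (here ≡.refl) inc) ⟩
      ∣ S ∣                        ∎
      where
      removed : ∀ e′ → e′ ∈ˡ E → Incident v e′ → other v e′ ∈ S ∖ other v e
      removed e′ e′∈E inc′ = x∈p∧x≢y⇒x∈p-y (h e′ (there e′∈E) inc′)
        (λ o≡ → All.lookup e∉E e′∈E (≡.sym (other-injective inc′ inc o≡)))

module _ {N : ℕ} (G : Graph N) where

  endpoint∈vertices : ∀ {e v} → e ∈ˡ edges G → Incident v e → v ∈ vertices G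
  endpoint∈vertices e∈E (inj₁ ≡.refl) = proj₁ (All.lookup (endpoints G) e∈E)
  endpoint∈vertices e∈E (inj₂ ≡.refl) = proj₂ (All.lookup (endpoints G) e∈E)

  degree⇒vertex : ∀ {v} → 1 ℕ.≤ degree (edges G) v → v ∈ vertices G
  degree⇒vertex 1≤d with degree⇒incident 1≤d
  ... | e , e∈E , inc = endpoint∈vertices e∈E inc

  degree-outside : ∀ v → v ∉ vertices G → degree (edges G) v ≡ 0
  degree-outside v v∉V with degree (edges G) v in eq
  ... | zero  = ≡.refl
  ... | suc d = contradiction (degree⇒vertex (≡.subst (1 ℕ.≤_) (≡.sym eq) (s≤s z≤n))) v∉V

  degree≤maxDegree : ∀ v → degree (edges G) v ℕ.≤ maxDegree G
  degree≤maxDegree v = All.lookup (All.map⁻ (xs≤max 0 _)) (∈-allFin v)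

  maxDegree-least : ∀ {k} → (∀ v → degree (edges G) v ℕ.≤ k) → maxDegree G ℕ.≤ k
  maxDegree-least h = max≤v⁺ z≤n (All.map⁺ (All.tabulate {xs = allFin N} (λ {v} _ → h v)))

  maxDegree≤order : maxDegree G ℕ.≤ order G
  maxDegree≤order = maxDegree-least λ v → degree≤∣S∣ (vertices G) v (edges G) (unique G) λ e e∈E _ → other∈V v e e∈E
    where
    other∈V : ∀ v e → e ∈ˡ edges G → other v e ∈ vertices G
    other∈V v e e∈E with does (v Fin.≟ lo e)
    ... | true  = endpoint∈vertices e∈E (inj₂ ≡.refl)
    ... | false = endpoint∈vertices e∈E (inj₁ ≡.refl)

  maxDegree≤size : maxDegree G ℕ.≤ size G
  maxDegree≤size = maxDegree-least λ v → length-filter (incident? v) (edges G)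

  2*size≤order*maxDegree : 2 ℕ.* size G ℕ.≤ order G ℕ.* maxDegree G
  2*size≤order*maxDegree = ≡.subst (ℕ._≤ order G ℕ.* maxDegree G) (handshake (edges G))
    (sum≤∣S∣* (vertices G) (degree (edges G)) (maxDegree G) degree≤maxDegree degree-outside)

  order≤2*size : NoIsolatedVertices G → order G ℕ.≤ 2 ℕ.* size G
  order≤2*size h = ≡.subst (order G ℕ.≤_) (handshake (edges G)) (sum≥∣S∣ (vertices G) (degree (edges G)) h)

  size≤order² : size G ℕ.≤ order G ℕ.* order G
  size≤order² = ℕ.≤-trans (ℕ.m≤m+n (size G) _) (ℕ.≤-trans 2*size≤order*maxDegree (ℕ.*-monoʳ-≤ (order G) maxDegree≤order))

  1≤maxDegree⇒1≤order : 1 ℕ.≤ maxDegree G → 1 ℕ.≤ order G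
  1≤maxDegree⇒1≤order 1≤Δ = ℕ.≤-trans 1≤Δ maxDegree≤order

-- One splitting step: degrees, sizes and merged colorings.

2*≤⇒≤⌊/2⌋ : ∀ {m n} → 2 ℕ.* m ℕ.≤ n → m ℕ.≤ ⌊ n /2⌋
2*≤⇒≤⌊/2⌋ {m} {n} 2m≤n = begin
  m                         ≡⟨ ℕ.n≡⌊n+n/2⌋ m ⟩
  ⌊ m ℕ.+ m /2⌋             ≡⟨ ≡.cong (λ k → ⌊ m ℕ.+ k /2⌋) (ℕ.+-identityʳ m) ⟨
  ⌊ 2 ℕ.* m /2⌋             ≤⟨ ℕ.⌊n/2⌋-mono 2m≤n ⟩
  ⌊ n /2⌋                   ∎
  where open ℕ.≤-Reasoning

2*⌊/2⌋≤ : ∀ n → 2 ℕ.* ⌊ n /2⌋ ℕ.≤ n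
2*⌊/2⌋≤ n = begin
  2 ℕ.* ⌊ n /2⌋                      ≡⟨ ≡.cong (⌊ n /2⌋ ℕ.+_) (ℕ.+-identityʳ _) ⟩
  ⌊ n /2⌋ ℕ.+ ⌊ n /2⌋                ≤⟨ ℕ.+-monoʳ-≤ ⌊ n /2⌋ (ℕ.⌊n/2⌋≤⌈n/2⌉ n) ⟩
  ⌊ n /2⌋ ℕ.+ ⌈ n /2⌉                ≡⟨ ℕ.⌊n/2⌋+⌈n/2⌉≡n n ⟩
  n                                  ∎
  where open ℕ.≤-Reasoning

≤2*⌊/2⌋+1 : ∀ n → n ℕ.≤ 2 ℕ.* ⌊ n /2⌋ ℕ.+ 1
≤2*⌊/2⌋+1 zero          = z≤n
≤2*⌊/2⌋+1 (suc zero)    = s≤s z≤n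
≤2*⌊/2⌋+1 (suc (suc n)) = begin
  2 ℕ.+ n                                  ≤⟨ ℕ.+-monoʳ-≤ 2 (≤2*⌊/2⌋+1 n) ⟩
  2 ℕ.+ (2 ℕ.* ⌊ n /2⌋ ℕ.+ 1)              ≡⟨ ≡.cong (ℕ._+ 1) (ℕ.*-suc 2 ⌊ n /2⌋) ⟨
  2 ℕ.* suc ⌊ n /2⌋ ℕ.+ 1                  ∎
  where open ℕ.≤-Reasoning

module _ {N : ℕ} (G : Graph N) (side : Edge N → Bool) where

  ∈-part⁺ : ∀ {e b} → e ∈ˡ edges G → side e ≡ b → e ∈ˡ edges (part G side b)
  ∈-part⁺ {b = b} = ∈-filter⁺ (λ e → side e Bool.≟ b)

  ∈-part⁻ : ∀ b {e} → e ∈ˡ edges (part G side b) → e ∈ˡ edges G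
  ∈-part⁻ b e∈ = proj₁ (∈-filter⁻ (λ e → side e Bool.≟ b) {xs = edges G} e∈)

  part-noIsolated : ∀ b → NoIsolatedVertices (part G side b)
  part-noIsolated b v = covered⇒degree {E = edges (part G side b)}

  order-part : ∀ b → order (part G side b) ℕ.≤ order G
  order-part b = p⊆q⇒∣p∣≤∣q∣ λ v∈ →
    let (_ , e∈ , inc) = degree⇒incident {E = edges (part G side b)} (part-noIsolated b _ v∈)
    in endpoint∈vertices G (∈-part⁻ b e∈) inc

  private
    d : Bool → Fin N → ℕ
    d b = degree (edges (part G side b))

  degree-parts : ∀ b v → d b v ℕ.+ d (not b) v ≡ degree (edges G) v
  degree-parts true  v = length-filter-sides (incident? v) side (edges G)
  degree-parts false v = ≡.trans (ℕ.+-comm (d false v) _) (degree-parts true v)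

  module _ (splitting : IsDegreeSplitting G side 2) where

    -- `IsDegreeSplitting` speaks of vertices only, while `maxDegree` ranges over all names. A name
    -- outside the graph has degree 0 in `G`, hence in both parts.
    discrepancy : ∀ v → ℕ.∣ d true v - d false v ∣ ℕ.≤ 2
    discrepancy v with v ∈? vertices G
    ... | yes v∈V = splitting v v∈V
    ... | no  v∉V
      rewrite ℕ.m+n≡0⇒m≡0 (d true v) (≡.trans (degree-parts true v) (degree-outside G v v∉V))
            | ℕ.m+n≡0⇒n≡0 (d true v) (≡.trans (degree-parts true v) (degree-outside G v v∉V)) = z≤n

    part-degree-close : ∀ b v → d b v ℕ.≤ d (not b) v ℕ.+ 2
    part-degree-close true  v = ℕ.≤-trans (ℕ.m≤n+∣m-n∣ (d true v) (d false v)) (ℕ.+-monoʳ-≤ _ (discrepancy v))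
    part-degree-close false v = ℕ.≤-trans (ℕ.m≤n+∣n-m∣ (d false v) (d true v)) (ℕ.+-monoʳ-≤ _ (discrepancy v))

    part-degree-upper : ∀ b v → 2 ℕ.* d b v ℕ.≤ degree (edges G) v ℕ.+ 2
    part-degree-upper b v = begin
      2 ℕ.* d b v                               ≡⟨ ≡.cong (d b v ℕ.+_) (ℕ.+-identityʳ _) ⟩
      d b v ℕ.+ d b v                           ≤⟨ ℕ.+-monoʳ-≤ (d b v) (part-degree-close b v) ⟩
      d b v ℕ.+ (d (not b) v ℕ.+ 2)             ≡⟨ ℕ.+-assoc (d b v) _ 2 ⟨
      d b v ℕ.+ d (not b) v ℕ.+ 2               ≡⟨ ≡.cong (ℕ._+ 2) (degree-parts b v) ⟩
      degree (edges G) v ℕ.+ 2                  ∎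
      where open ℕ.≤-Reasoning

    part-degree-lower : ∀ b v → degree (edges G) v ℕ.≤ 2 ℕ.* d b v ℕ.+ 2
    part-degree-lower b v = begin
      degree (edges G) v                   ≡⟨ degree-parts b v ⟨
      d b v ℕ.+ d (not b) v                ≤⟨ ℕ.+-monoʳ-≤ (d b v) (close b) ⟩
      d b v ℕ.+ (d b v ℕ.+ 2)
        ≡⟨ solve 1 (λ x → x :+ (x :+ con 2) := con 2 :* x :+ con 2) ≡.refl (d b v) ⟩
      2 ℕ.* d b v ℕ.+ 2                    ∎
      where
      open ℕ.≤-Reasoning
      open +-*-Solver
      close : ∀ b → d (not b) v ℕ.≤ d b v ℕ.+ 2
      close true  = part-degree-close false v
      close false = part-degree-close true v

    -- `maxDegree-least` bounds a degree and not its double, so the bound is first halved and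
    -- rounded down, which loses nothing for integers.
    maxDegree-part-upper : ∀ b → 2 ℕ.* maxDegree (part G side b) ℕ.≤ maxDegree G ℕ.+ 2
    maxDegree-part-upper b = begin
      2 ℕ.* maxDegree (part G side b)  ≤⟨ ℕ.*-monoʳ-≤ 2 (maxDegree-least (part G side b) half) ⟩
      2 ℕ.* ⌊ maxDegree G ℕ.+ 2 /2⌋    ≤⟨ 2*⌊/2⌋≤ _ ⟩
      maxDegree G ℕ.+ 2                ∎
      where
      open ℕ.≤-Reasoning
      half : ∀ v → d b v ℕ.≤ ⌊ maxDegree G ℕ.+ 2 /2⌋
      half v = 2*≤⇒≤⌊/2⌋ (ℕ.≤-trans (part-degree-upper b v) (ℕ.+-monoˡ-≤ 2 (degree≤maxDegree G v)))

    maxDegree-part-lower : ∀ b → maxDegree G ℕ.≤ 2 ℕ.* maxDegree (part G side b) ℕ.+ 2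
    maxDegree-part-lower b = maxDegree-least G λ v → ℕ.≤-trans (part-degree-lower b v)
      (ℕ.+-monoˡ-≤ 2 (ℕ.*-monoʳ-≤ 2 (degree≤maxDegree (part G side b) v)))

  size-parts : IsBalanced G side → size (part G side true) ℕ.+ size (part G side false) ≡ size G
  size-parts (inj₁ (s₁ , s₂)) = ≡.trans (≡.cong₂ ℕ._+_ s₁ s₂) (ℕ.⌊n/2⌋+⌈n/2⌉≡n (size G))
  size-parts (inj₂ (s₁ , s₂)) =
    ≡.trans (≡.cong₂ ℕ._+_ s₁ s₂) (≡.trans (ℕ.+-comm ⌈ size G /2⌉ _) (ℕ.⌊n/2⌋+⌈n/2⌉≡n (size G)))

  size-part-lower : IsBalanced G side → ∀ b → size G ℕ.≤ 2 ℕ.* size (part G side b) ℕ.+ 1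
  size-part-lower balanced b = begin
    size G                                 ≤⟨ ≤2*⌊/2⌋+1 (size G) ⟩
    2 ℕ.* ⌊ size G /2⌋ ℕ.+ 1               ≤⟨ ℕ.+-monoˡ-≤ 1 (ℕ.*-monoʳ-≤ 2 (half balanced b)) ⟩
    2 ℕ.* size (part G side b) ℕ.+ 1       ∎
    where
    open ℕ.≤-Reasoning
    floor≤ : ∀ {m} → m ≡ ⌊ size G /2⌋ → ⌊ size G /2⌋ ℕ.≤ m
    floor≤ eq = ℕ.≤-reflexive (≡.sym eq)
    ceil≤ : ∀ {m} → m ≡ ⌈ size G /2⌉ → ⌊ size G /2⌋ ℕ.≤ m
    ceil≤ eq = ℕ.≤-trans (ℕ.⌊n/2⌋≤⌈n/2⌉ (size G)) (ℕ.≤-reflexive (≡.sym eq))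
    half : IsBalanced G side → ∀ b → ⌊ size G /2⌋ ℕ.≤ size (part G side b)
    half (inj₁ (s₁ , s₂)) true  = floor≤ s₁
    half (inj₁ (s₁ , s₂)) false = ceil≤ s₂
    half (inj₂ (s₁ , s₂)) true  = ceil≤ s₁
    half (inj₂ (s₁ , s₂)) false = floor≤ s₂

  merge-proper : ∀ (φ₁ φ₂ : Coloring N) →
    IsProperColoring (part G side true) (palette φ₁) (color φ₁) →
    IsProperColoring (part G side false) (palette φ₂) (color φ₂) →
    IsProperColoring G (palette (merge side φ₁ φ₂)) (color (merge side φ₁ φ₂))
  merge-proper φ₁ φ₂ (range₁ , proper₁) (range₂ , proper₂) =
    All.tabulate in-range ,
    All.tabulate (λ e∈E → All.tabulate (λ e′∈E → distinct e∈E e′∈E))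
    where
    p₁ = palette φ₁
    φ  = color (merge side φ₁ φ₂)

    in-range : ∀ {e} → e ∈ˡ edges G → 1 ℕ.≤ φ e × φ e ℕ.≤ p₁ ℕ.+ palette φ₂
    in-range {e} e∈E with side e in eq
    ... | true  = let (1≤ , ≤p) = All.lookup range₁ (∈-part⁺ e∈E eq)
                  in 1≤ , ℕ.≤-trans ≤p (ℕ.m≤m+n _ _)
    ... | false = let (1≤ , ≤p) = All.lookup range₂ (∈-part⁺ e∈E eq)
                  in ℕ.≤-trans 1≤ (ℕ.m≤n+m _ _) , ℕ.+-monoʳ-≤ p₁ ≤p

    -- Colors start at 1, so the shift by `p₁` puts the second palette strictly above the first.
    separated : ∀ {e e′} → e ∈ˡ edges (part G side true) → e′ ∈ˡ edges (part G side false) →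
                color φ₁ e ≢ p₁ ℕ.+ color φ₂ e′
    separated e∈₁ e′∈₂ = ℕ.<⇒≢ (ℕ.≤-trans (s≤s (proj₂ (All.lookup range₁ e∈₁)))
      (ℕ.≤-trans (ℕ.≤-reflexive (ℕ.+-comm 1 p₁)) (ℕ.+-monoʳ-≤ p₁ (proj₁ (All.lookup range₂ e′∈₂)))))

    distinct : ∀ {e e′} → e ∈ˡ edges G → e′ ∈ˡ edges G → e ≢ e′ → SharesEndpoint e e′ → φ e ≢ φ e′
    distinct {e} {e′} e∈E e′∈E e≢e′ share with side e in eq | side e′ in eq′
    ... | true  | true  = All.lookup (All.lookup proper₁ (∈-part⁺ e∈E eq)) (∈-part⁺ e′∈E eq′) e≢e′ share
    ... | true  | false = separated (∈-part⁺ e∈E eq) (∈-part⁺ e′∈E eq′)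
    ... | false | true  = separated (∈-part⁺ e′∈E eq′) (∈-part⁺ e∈E eq) ∘ ≡.sym
    ... | false | false = All.lookup (All.lookup proper₂ (∈-part⁺ e∈E eq)) (∈-part⁺ e′∈E eq′) e≢e′ share ∘ ℕ.+-cancelˡ-≡ p₁ _ _

-- Ordered-field arithmetic, powers of two and logarithms.

module OrderedField (ℛ : Reals) where
  open Reals ℛ

  module CR = CommutativeRing commutativeRing
  module O  = IsDecTotalOrder isDecTotalOrder
  open Algebra.Properties.Semiring.Mult CR.semiring using (×-homo-+; ×1-homo-*)
  open Algebra.Solver.Ring.NaturalCoefficients.Default CR.commutativeSemiring
    using (Polynomial; solve; _:=_; _:+_; _:*_; con)

  poset : Poset 0ℓ 0ℓ 0ℓ
  poset = record { isPartialOrder = O.isPartialOrder }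

  module ≤-R = Relation.Binary.Reasoning.PartialOrder poset

  -- Evaluates to the very sum that `fromℕ k` unfolds to, ending in `0#`, so solved identities match
  -- goals with numerals; `con 1` is `1#` and not `fromℕ 1`.
  num : ∀ {n} → ℕ → Polynomial n
  num zero    = con 0
  num (suc k) = con 1 :+ num k

  +-monoˡ-≤ : ∀ z {x y} → x ≤ y → x + z ≤ y + z
  +-monoˡ-≤ z x≤y = O.≤-respˡ-≈ (CR.+-comm z _) (O.≤-respʳ-≈ (CR.+-comm z _) (+-monoʳ-≤ z x≤y))

  +-mono-≤ : ∀ {w x y z} → w ≤ x → y ≤ z → w + y ≤ x + z
  +-mono-≤ {x = x} {y} w≤x y≤z = O.trans (+-monoˡ-≤ y w≤x) (+-monoʳ-≤ x y≤z)

  -- Trades an inequality for a nonnegative summand, which leaves subtraction-free identities that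
  -- the semiring solver can decide.
  ≤⇒+ : ∀ {x y} → x ≤ y → ∃ λ d → 0# ≤ d × y ≈ x + d
  ≤⇒+ {x} {y} x≤y = y - x , O.≤-respˡ-≈ (CR.-‿inverseʳ x) (+-monoˡ-≤ (- x) x≤y) , (begin-equality
    y                ≈⟨ CR.+-identityʳ y ⟨
    y + 0#           ≈⟨ CR.+-congˡ (CR.-‿inverseˡ x) ⟨
    y + (- x + x)    ≈⟨ solve 3 (λ y x x⁻ → y :+ (x⁻ :+ x) := x :+ (y :+ x⁻)) CR.refl y x (- x) ⟩
    x + (y - x)      ∎)
    where open ≤-R

  +-≤ : ∀ {x d} → 0# ≤ d → x ≤ x + d
  +-≤ {x} 0≤d = O.≤-respˡ-≈ (CR.+-identityʳ x) (+-monoʳ-≤ x 0≤d)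

  +-cancelʳ-≤ : ∀ z {x y} → x + z ≤ y + z → x ≤ y
  +-cancelʳ-≤ z {x} {y} x+z≤y+z = O.≤-respˡ-≈ (undo x) (O.≤-respʳ-≈ (undo y) (+-monoˡ-≤ (- z) x+z≤y+z))
    where
    open ≤-R
    undo : ∀ w → w + z + - z ≈ w
    undo w = begin-equality
      w + z + - z      ≈⟨ CR.+-assoc w z (- z) ⟩
      w + (z + - z)    ≈⟨ CR.+-congˡ (CR.-‿inverseʳ z) ⟩
      w + 0#           ≈⟨ CR.+-identityʳ w ⟩
      w                ∎

  -≤⇒≤+ : ∀ {x y z} → x - y ≤ z → x ≤ z + y
  -≤⇒≤+ {x} {y} {z} h = +-cancelʳ-≤ (- y) (begin
    x - y          ≤⟨ h ⟩
    z              ≈⟨ CR.+-identityʳ z ⟨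
    z + 0#         ≈⟨ CR.+-congˡ (CR.-‿inverseʳ y) ⟨
    z + (y - y)    ≈⟨ CR.+-assoc z y (- y) ⟨
    z + y - y      ∎)
    where open ≤-R

  ≤+⇒-≤ : ∀ {x y z} → x ≤ z + y → x - y ≤ z
  ≤+⇒-≤ {x} {y} {z} h = begin
    x - y          ≤⟨ +-monoˡ-≤ (- y) h ⟩
    z + y - y      ≈⟨ CR.+-assoc z y (- y) ⟩
    z + (y - y)    ≈⟨ CR.+-congˡ (CR.-‿inverseʳ y) ⟩
    z + 0#         ≈⟨ CR.+-identityʳ z ⟩
    z              ∎
    where open ≤-R

  *-monoʳ-≤ : ∀ {z x y} → 0# ≤ z → x ≤ y → z * x ≤ z * y
  *-monoʳ-≤ {z} {x} {y} 0≤z x≤y = let (d , 0≤d , y≈) = ≤⇒+ x≤y in begin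
    z * x            ≤⟨ +-≤ (*-nonneg 0≤z 0≤d) ⟩
    z * x + z * d    ≈⟨ CR.distribˡ z x d ⟨
    z * (x + d)      ≈⟨ CR.*-congˡ y≈ ⟨
    z * y            ∎
    where open ≤-R

  *-monoˡ-≤ : ∀ {z x y} → 0# ≤ z → x ≤ y → x * z ≤ y * z
  *-monoˡ-≤ 0≤z x≤y = O.≤-respˡ-≈ (CR.*-comm _ _) (O.≤-respʳ-≈ (CR.*-comm _ _) (*-monoʳ-≤ 0≤z x≤y))

  *-mono-≤ : ∀ {w x y z} → 0# ≤ w → w ≤ x → 0# ≤ y → y ≤ z → w * y ≤ x * z
  *-mono-≤ 0≤w w≤x 0≤y y≤z = O.trans (*-monoˡ-≤ 0≤y w≤x) (*-monoʳ-≤ (O.trans 0≤w w≤x) y≤z)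

  0≤x² : ∀ x → 0# ≤ x * x
  0≤x² x with O.total 0# x
  ... | inj₁ 0≤x = *-nonneg 0≤x 0≤x
  -- Here `d` is `- x`. The chain adds `x * (x + d)` and removes `d * (x + d)`, both of which
  -- vanish.
  ... | inj₂ x≤0 = let (d , 0≤d , 0≈x+d) = ≤⇒+ x≤0 in begin
    0#               ≤⟨ *-nonneg 0≤d 0≤d ⟩
    d * d            ≈⟨ CR.+-identityˡ _ ⟨
    0# + d * d       ≈⟨ CR.+-congʳ (CR.zeroʳ x) ⟨
    x * 0# + d * d           ≈⟨ CR.+-congʳ (CR.*-congˡ 0≈x+d) ⟩
    x * (x + d) + d * d      ≈⟨ solve 2 (λ x d → x :* (x :+ d) :+ d :* d := x :* x :+ d :* (x :+ d)) CR.refl x d ⟩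
    x * x + d * (x + d)      ≈⟨ CR.+-congˡ (CR.*-congˡ 0≈x+d) ⟨
    x * x + d * 0#           ≈⟨ CR.+-congˡ (CR.zeroʳ d) ⟩
    x * x + 0#       ≈⟨ CR.+-identityʳ _ ⟩
    x * x            ∎
    where open ≤-R

  0≤1 : 0# ≤ 1#
  0≤1 = O.≤-respʳ-≈ (CR.*-identityˡ 1#) (0≤x² 1#)

  0≤fromℕ : ∀ n → 0# ≤ fromℕ n
  0≤fromℕ zero    = O.refl
  0≤fromℕ (suc n) = O.trans 0≤1 (+-≤ (0≤fromℕ n))

  fromℕ-+ : ∀ m n → fromℕ (m ℕ.+ n) ≈ fromℕ m + fromℕ n
  fromℕ-+ = ×-homo-+ 1#

  fromℕ-* : ∀ m n → fromℕ (m ℕ.* n) ≈ fromℕ m * fromℕ n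
  fromℕ-* = ×1-homo-*

  fromℕ-mono : ∀ {m n} → m ℕ.≤ n → fromℕ m ≤ fromℕ n
  fromℕ-mono {n = n} z≤n = 0≤fromℕ n
  fromℕ-mono (s≤s m≤n) = +-monoʳ-≤ 1# (fromℕ-mono m≤n)

  fromℕ-1 : fromℕ 1 ≈ 1#
  fromℕ-1 = CR.+-identityʳ 1#

  1≤fromℕ : ∀ {n} → 1 ℕ.≤ n → 1# ≤ fromℕ n
  1≤fromℕ 1≤n = O.≤-respˡ-≈ fromℕ-1 (fromℕ-mono 1≤n)

  <-≤-trans : ∀ {x y z} → x < y → y ≤ z → x < z
  <-≤-trans (x≤y , x≉y) y≤z =
    O.trans x≤y y≤z , λ x≈z → x≉y (O.antisym x≤y (O.≤-respʳ-≈ (CR.sym x≈z) y≤z))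

  0<1 : 0# < 1#
  0<1 = 0≤1 , 0≉1

  1≤⇒0< : ∀ {x} → 1# ≤ x → 0# < x
  1≤⇒0< = <-≤-trans 0<1

  0<fromℕ : ∀ {n} → 1 ℕ.≤ n → 0# < fromℕ n
  0<fromℕ 1≤n = 1≤⇒0< (1≤fromℕ 1≤n)

  *-inv : ∀ {x} → 0# < x → x * x ⁻¹ ≈ 1#
  *-inv (_ , 0≉x) = *-inverseʳ (λ x≈0 → 0≉x (CR.sym x≈0))

  *-inv-cancel : ∀ {x} y → 0# < x → x * (x ⁻¹ * y) ≈ y
  *-inv-cancel {x} y 0<x = begin-equality
    x * (x ⁻¹ * y)    ≈⟨ CR.*-assoc x _ y ⟨
    x * x ⁻¹ * y      ≈⟨ CR.*-congʳ (*-inv 0<x) ⟩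
    1# * y            ≈⟨ CR.*-identityˡ y ⟩
    y                 ∎
    where open ≤-R

  inv-*-cancel : ∀ {x} y → 0# < x → x ⁻¹ * (x * y) ≈ y
  inv-*-cancel {x} y 0<x = begin-equality
    x ⁻¹ * (x * y)    ≈⟨ solve 3 (λ a b c → b :* (a :* c) := a :* (b :* c)) CR.refl x (x ⁻¹) y ⟩
    x * (x ⁻¹ * y)    ≈⟨ *-inv-cancel y 0<x ⟩
    y                 ∎
    where open ≤-R

  0≤⁻¹ : ∀ {x} → 0# < x → 0# ≤ x ⁻¹
  0≤⁻¹ {x} 0<x@(0≤x , _) with O.total 0# (x ⁻¹)
  ... | inj₁ 0≤x⁻¹ = 0≤x⁻¹
  ... | inj₂ x⁻¹≤0 = ⊥-elim (0≉1 (O.antisym 0≤1 (begin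
    1#          ≈⟨ *-inv 0<x ⟨
    x * x ⁻¹    ≤⟨ *-monoʳ-≤ 0≤x x⁻¹≤0 ⟩
    x * 0#      ≈⟨ CR.zeroʳ x ⟩
    0#          ∎)))
    where open ≤-R

  *-cancelˡ-≤ : ∀ {z x y} → 0# < z → z * x ≤ z * y → x ≤ y
  *-cancelˡ-≤ {x = x} {y} 0<z zx≤zy =
    O.≤-respˡ-≈ (inv-*-cancel x 0<z) (O.≤-respʳ-≈ (inv-*-cancel y 0<z) (*-monoʳ-≤ (0≤⁻¹ 0<z) zx≤zy))

  *-pos : ∀ {x y} → 0# < x → 0# < y → 0# < x * y
  *-pos {x} {y} 0<x@(0≤x , _) (0≤y , 0≉y) = *-nonneg 0≤x 0≤y , λ 0≈xy → 0≉y (begin-equality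
    0#                ≈⟨ CR.zeroʳ _ ⟨
    x ⁻¹ * 0#         ≈⟨ CR.*-congˡ 0≈xy ⟩
    x ⁻¹ * (x * y)    ≈⟨ inv-*-cancel y 0<x ⟩
    y                 ∎)
    where open ≤-R

  ≤*⇒/≤ : ∀ {x y z} → 0# < z → x ≤ y * z → x / z ≤ y
  ≤*⇒/≤ {x} {y} {z} 0<z x≤yz = *-cancelˡ-≤ 0<z (begin
    z * (x * z ⁻¹)    ≈⟨ CR.*-congˡ (CR.*-comm x _) ⟩
    z * (z ⁻¹ * x)    ≈⟨ *-inv-cancel x 0<z ⟩
    x                 ≤⟨ x≤yz ⟩
    y * z             ≈⟨ CR.*-comm y z ⟩
    z * y             ∎)
    where open ≤-R

  *≤⇒≤/ : ∀ {x y z} → 0# < z → x * z ≤ y → x ≤ y / z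
  *≤⇒≤/ {x} {y} {z} 0<z xz≤y = *-cancelˡ-≤ 0<z (begin
    z * x             ≈⟨ CR.*-comm z x ⟩
    x * z             ≤⟨ xz≤y ⟩
    y                 ≈⟨ *-inv-cancel y 0<z ⟨
    z * (z ⁻¹ * y)    ≈⟨ CR.*-congˡ (CR.*-comm _ y) ⟩
    z * (y / z)       ∎)
    where open ≤-R

  /≤⇒≤* : ∀ {x y z} → 0# < z → x / z ≤ y → x ≤ y * z
  /≤⇒≤* {x} {y} {z} 0<z@(0≤z , _) x/z≤y = begin
    x                 ≈⟨ *-inv-cancel x 0<z ⟨
    z * (z ⁻¹ * x)    ≈⟨ solve 3 (λ z i x → z :* (i :* x) := x :* i :* z) CR.refl z (z ⁻¹) x ⟩
    x / z * z         ≤⟨ *-monoˡ-≤ 0≤z x/z≤y ⟩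
    y * z             ∎
    where open ≤-R

  ≤/⇒*≤ : ∀ {x y z} → 0# < z → x ≤ y / z → x * z ≤ y
  ≤/⇒*≤ {x} {y} {z} 0<z@(0≤z , _) x≤y/z = begin
    x * z             ≤⟨ *-monoˡ-≤ 0≤z x≤y/z ⟩
    y / z * z         ≈⟨ solve 3 (λ z i y → y :* i :* z := z :* (i :* y)) CR.refl z (z ⁻¹) y ⟩
    z * (z ⁻¹ * y)    ≈⟨ *-inv-cancel y 0<z ⟩
    y                 ∎
    where open ≤-R

  1/-anti : ∀ {x y} → 0# < x → x ≤ y → 1# / y ≤ 1# / x
  1/-anti {x} {y} 0<x x≤y = ≤*⇒/≤ 0<y (begin
    1#                ≈⟨ *-inv 0<x ⟨
    x * x ⁻¹          ≤⟨ *-monoˡ-≤ (0≤⁻¹ 0<x) x≤y ⟩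
    y * x ⁻¹          ≈⟨ solve 2 (λ y i → y :* i := con 1 :* i :* y) CR.refl y (x ⁻¹) ⟩
    1# / x * y        ∎)
    where
    open ≤-R
    0<y = <-≤-trans 0<x x≤y

  ^-nonneg : ∀ {x} k → 0# ≤ x → 0# ≤ x ^ k
  ^-nonneg zero    0≤x = 0≤1
  ^-nonneg (suc k) 0≤x = *-nonneg 0≤x (^-nonneg k 0≤x)

  ^-monoˡ-≤ : ∀ {x y} k → 0# ≤ x → x ≤ y → x ^ k ≤ y ^ k
  ^-monoˡ-≤ zero    0≤x x≤y = O.refl
  ^-monoˡ-≤ (suc k) 0≤x x≤y = *-mono-≤ 0≤x x≤y (^-nonneg k 0≤x) (^-monoˡ-≤ k 0≤x x≤y)

  1≤^ : ∀ {x} k → 1# ≤ x → 1# ≤ x ^ k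
  1≤^ zero    1≤x = O.refl
  1≤^ (suc k) 1≤x = O.≤-respˡ-≈ (CR.*-identityˡ 1#) (*-mono-≤ 0≤1 1≤x 0≤1 (1≤^ k 1≤x))

  ^-monoʳ-≤ : ∀ {x} → 1# ≤ x → ∀ {j k} → j ℕ.≤ k → x ^ j ≤ x ^ k
  ^-monoʳ-≤ 1≤x {k = k} z≤n = 1≤^ k 1≤x
  ^-monoʳ-≤ 1≤x (s≤s j≤k)   = *-monoʳ-≤ (O.trans 0≤1 1≤x) (^-monoʳ-≤ 1≤x j≤k)

  *-^ : ∀ x y k → (x * y) ^ k ≈ x ^ k * y ^ k
  *-^ x y zero    = CR.sym (CR.*-identityˡ 1#)
  *-^ x y (suc k) = CR.trans (CR.*-congˡ (*-^ x y k))
    (solve 4 (λ x y a b → x :* y :* (a :* b) := x :* a :* (y :* b)) CR.refl x y (x ^ k) (y ^ k))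

  fromℕ-^ : ∀ b k → fromℕ (b ℕ.^ k) ≈ fromℕ b ^ k
  fromℕ-^ b zero    = fromℕ-1
  fromℕ-^ b (suc k) = CR.trans (fromℕ-* b (b ℕ.^ k)) (CR.*-congˡ (fromℕ-^ b k))

  -- The gap is the square of the difference `d`. This decouples leaf degree from leaf logarithm,
  -- and later absorbs a linear term into a square.
  xy+xy≤x²+y² : ∀ x y → x * y + x * y ≤ x * x + y * y
  xy+xy≤x²+y² x y with O.total x y
  ... | inj₁ x≤y = amgm x≤y
    where
    open ≤-R
    amgm : ∀ {x y} → x ≤ y → x * y + x * y ≤ x * x + y * y
    amgm {x} {y} x≤y = let (d , 0≤d , y≈) = ≤⇒+ x≤y in begin
      x * y + x * y                      ≈⟨ CR.+-cong (CR.*-congˡ y≈) (CR.*-congˡ y≈) ⟩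
      x * (x + d) + x * (x + d)          ≤⟨ +-≤ (*-nonneg 0≤d 0≤d) ⟩
      x * (x + d) + x * (x + d) + d * d
        ≈⟨ solve 2 (λ x d → x :* (x :+ d) :+ x :* (x :+ d) :+ d :* d := x :* x :+ (x :+ d) :* (x :+ d))
             CR.refl x d ⟩
      x * x + (x + d) * (x + d)          ≈⟨ CR.+-congˡ (CR.*-cong y≈ y≈) ⟨
      x * x + y * y                      ∎
  ... | inj₂ y≤x = let (d , 0≤d , x≈) = ≤⇒+ y≤x in begin
      x * y + x * y                      ≈⟨ CR.+-cong (CR.*-congʳ x≈) (CR.*-congʳ x≈) ⟩
      (y + d) * y + (y + d) * y          ≤⟨ +-≤ (*-nonneg 0≤d 0≤d) ⟩
      (y + d) * y + (y + d) * y + d * d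
        ≈⟨ solve 2 (λ x d → (x :+ d) :* x :+ (x :+ d) :* x :+ d :* d := (x :+ d) :* (x :+ d) :+ x :* x)
             CR.refl y d ⟩
      (y + d) * (y + d) + y * y          ≈⟨ CR.+-congʳ (CR.*-cong x≈ x≈) ⟨
      x * x + y * y                      ∎
    where open ≤-R

  -- The constants of the base subroutines come without a sign; monotonicity of products needs them
  -- nonnegative.
  majorant : ∀ x → ∃ λ y → 0# ≤ y × x ≤ y
  majorant x with O.total 0# x
  ... | inj₁ 0≤x = x , 0≤x , O.refl
  ... | inj₂ x≤0 = 0# , O.refl , x≤0

  2^-cong : ∀ {x y} → x ≈ y → 2^ x ≈ 2^ y
  2^-cong x≈y = O.antisym (2^-mono (O.reflexive x≈y)) (2^-mono (O.reflexive (CR.sym x≈y)))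

  -- By the addition law one zero value would make `2^ 1#` zero, yet it is 2.
  2^≉0 : ∀ x → ¬ (2^ x ≈ 0#)
  2^≉0 x 2^x≈0 = proj₂ (1≤⇒0< (+-≤ {1#} 0≤1)) (begin-equality
    0#                        ≈⟨ CR.zeroˡ _ ⟨
    0# * 2^ (1# - x)          ≈⟨ CR.*-congʳ 2^x≈0 ⟨
    2^ x * 2^ (1# - x)        ≈⟨ 2^-+ x (1# - x) ⟨
    2^ (x + (1# - x))
      ≈⟨ 2^-cong (solve 3 (λ x a n → x :+ (a :+ n) := a :+ (x :+ n)) CR.refl x 1# (- x)) ⟩
    2^ (1# + (x - x))
      ≈⟨ 2^-cong (CR.trans (CR.+-congˡ (CR.-‿inverseʳ x)) (CR.+-identityʳ 1#)) ⟩
    2^ 1#                     ≈⟨ 2^-1 ⟩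
    1# + 1#                   ∎)
    where open ≤-R

  2^-0 : 2^ 0# ≈ 1#
  2^-0 = begin-equality
    2^ 0#                             ≈⟨ CR.*-identityʳ _ ⟨
    2^ 0# * 1#                        ≈⟨ CR.*-congˡ (*-inverseʳ (2^≉0 0#)) ⟨
    2^ 0# * (2^ 0# * (2^ 0#) ⁻¹)      ≈⟨ CR.*-assoc _ _ _ ⟨
    2^ 0# * 2^ 0# * (2^ 0#) ⁻¹        ≈⟨ CR.*-congʳ (2^-+ 0# 0#) ⟨
    2^ (0# + 0#) * (2^ 0#) ⁻¹         ≈⟨ CR.*-congʳ (2^-cong (CR.+-identityʳ 0#)) ⟩
    2^ 0# * (2^ 0#) ⁻¹                ≈⟨ *-inverseʳ (2^≉0 0#) ⟩
    1#                                ∎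
    where open ≤-R

  half : ℝ
  half = 1# / fromℕ 2

  half+half : half + half ≈ 1#
  half+half = begin-equality
    half + half              ≈⟨ solve 1 (λ i → con 1 :* i :+ con 1 :* i := num 2 :* i) CR.refl (fromℕ 2 ⁻¹) ⟩
    fromℕ 2 * fromℕ 2 ⁻¹     ≈⟨ *-inv (0<fromℕ {2} (s≤s z≤n)) ⟩
    1#                       ∎
    where open ≤-R

  halves : ∀ x → half * x + half * x ≈ x
  halves x = CR.trans (CR.sym (CR.distribʳ x half half)) (CR.trans (CR.*-congʳ half+half) (CR.*-identityˡ x))

  -- Every value of `2^_` is a square, hence nonnegative; the same identity later supplies the
  -- square root of a vertex count.
  2^-half² : ∀ x → 2^ (half * x) * 2^ (half * x) ≈ 2^ x
  2^-half² x = CR.trans (CR.sym (2^-+ _ _)) (2^-cong (halves x))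

  0<2^ : ∀ x → 0# < 2^ x
  0<2^ x = O.≤-respʳ-≈ (2^-half² x) (0≤x² _) , λ 0≈ → 2^≉0 x (CR.sym 0≈)

  2^-fromℕ : ∀ k → 2^ (fromℕ k) ≈ fromℕ (2 ℕ.^ k)
  2^-fromℕ zero    = CR.trans 2^-0 (CR.sym fromℕ-1)
  2^-fromℕ (suc k) = begin-equality
    2^ (1# + fromℕ k)             ≈⟨ 2^-+ 1# (fromℕ k) ⟩
    2^ 1# * 2^ (fromℕ k)          ≈⟨ CR.*-cong 2^-1 (2^-fromℕ k) ⟩
    (1# + 1#) * fromℕ (2 ℕ.^ k)   ≈⟨ CR.*-congʳ (CR.+-congˡ fromℕ-1) ⟨
    fromℕ 2 * fromℕ (2 ℕ.^ k)     ≈⟨ fromℕ-* 2 (2 ℕ.^ k) ⟨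
    fromℕ (2 ℕ.^ suc k)           ∎
    where open ≤-R

  2^≤⇒≤log : ∀ {x y} → 2^ x ≤ y → x ≤ log₂ y
  2^≤⇒≤log {x} 2^x≤y = O.≤-respˡ-≈ (log-2^ x) (log-mono (0<2^ x) 2^x≤y)

  ≤2^⇒log≤ : ∀ {x y} → 0# < x → x ≤ 2^ y → log₂ x ≤ y
  ≤2^⇒log≤ {y = y} 0<x x≤2^y = O.≤-respʳ-≈ (log-2^ y) (log-mono 0<x x≤2^y)

  2^ℕ≤⇒≤log : ∀ {k x} → fromℕ (2 ℕ.^ k) ≤ x → fromℕ k ≤ log₂ x
  2^ℕ≤⇒≤log {k} 2^k≤x = 2^≤⇒≤log (O.≤-respˡ-≈ (CR.sym (2^-fromℕ k)) 2^k≤x)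

  0≤log : ∀ {x} → 1# ≤ x → 0# ≤ log₂ x
  0≤log 1≤x = 2^≤⇒≤log (O.≤-respˡ-≈ (CR.sym 2^-0) 1≤x)

  log≤⇒≤2^ : ∀ {x y} → 0# < x → log₂ x ≤ y → x ≤ 2^ y
  log≤⇒≤2^ 0<x logx≤y = O.≤-respˡ-≈ (2^-log 0<x) (2^-mono logx≤y)

  ≤log⇒2^≤ : ∀ {x y} → 0# < y → x ≤ log₂ y → 2^ x ≤ y
  ≤log⇒2^≤ 0<y x≤logy = O.≤-respʳ-≈ (2^-log 0<y) (2^-mono x≤logy)

  -[1+k]+1≤0 : ∀ k → fromℤ -[1+ k ] + 1# ≤ 0#
  -[1+k]+1≤0 k = begin
    - fromℕ (suc k) + 1#               ≤⟨ +-monoʳ-≤ _ (1≤fromℕ {suc k} (s≤s z≤n)) ⟩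
    - fromℕ (suc k) + fromℕ (suc k)    ≈⟨ CR.-‿inverseˡ _ ⟩
    0#                                 ∎
    where open ≤-R

  -- Reduces to `k + 1 ≤ 2 ^ k` at the floor `k`; below a negative floor the left side is at most 0.
  -- Applied to half a logarithm it compares that with a square root.
  x≤2^x : ∀ x → x ≤ 2^ x
  x≤2^x x with ⌊ x ⌋ | ⌊⌋-lower x | ⌊⌋-upper x
  ... | + k      | k≤x | x<k+1 , _ = begin
    x                       ≤⟨ x<k+1 ⟩
    fromℕ k + 1#            ≈⟨ CR.+-comm _ _ ⟩
    fromℕ (suc k)           ≤⟨ fromℕ-mono (k<2^k k) ⟩
    fromℕ (2 ℕ.^ k)         ≈⟨ 2^-fromℕ k ⟨
    2^ (fromℕ k)            ≤⟨ 2^-mono k≤x ⟩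
    2^ x                    ∎
    where
    open ≤-R
    k<2^k : ∀ k → k ℕ.< 2 ℕ.^ k
    k<2^k zero    = s≤s z≤n
    k<2^k (suc k) = ℕ.+-mono-≤ (ℕ.≤-trans (s≤s z≤n) (k<2^k k)) (ℕ.≤-trans (k<2^k k) (ℕ.m≤m+n _ 0))
  ... | -[1+ k ] | _   | x<k+1 , _ = O.trans x<k+1 (O.trans (-[1+k]+1≤0 k) (proj₁ (0<2^ x)))

  depth-upper : ∀ {x} → 0# < x → x ≤ fromℕ (2 ℕ.^ suc (EdgeColoring.depth ℛ x))
  depth-upper {x} 0<x with ⌊ log₂ x ⌋ | ⌊⌋-upper (log₂ x)
  ... | + k | l<k+1 , _ = begin
    x                         ≤⟨ log≤⇒≤2^ 0<x (O.trans l<k+1 (O.reflexive (CR.+-comm _ _))) ⟩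
    2^ (fromℕ (suc k))        ≈⟨ 2^-fromℕ (suc k) ⟩
    fromℕ (2 ℕ.^ suc k)       ≡⟨ ≡.cong (λ j → fromℕ (2 ℕ.^ suc j)) (ℕ.⊔-identityʳ k) ⟨
    fromℕ (2 ℕ.^ suc (k ℕ.⊔ 0))  ∎
    where open ≤-R
  ... | -[1+ k ] | l<k+1 , _ = begin
    x                         ≤⟨ log≤⇒≤2^ 0<x (O.trans l<k+1 (-[1+k]+1≤0 k)) ⟩
    2^ 0#                     ≈⟨ 2^-0 ⟩
    1#                        ≤⟨ 1≤fromℕ {2} (s≤s z≤n) ⟩
    fromℕ 2                   ∎
    where open ≤-R

  -- The first alternative accounts for clamping at 0: there `2 ^ 0` may exceed `x`.
  depth-lower : ∀ {x} → 0# < x → EdgeColoring.depth ℛ x ≡ 0 ⊎ fromℕ (2 ℕ.^ EdgeColoring.depth ℛ x) ≤ x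
  depth-lower {x} 0<x with ⌊ log₂ x ⌋ | ⌊⌋-lower (log₂ x)
  ... | + k | k≤l = inj₂ (begin
    fromℕ (2 ℕ.^ (k ℕ.⊔ 0))   ≡⟨ ≡.cong (λ j → fromℕ (2 ℕ.^ j)) (ℕ.⊔-identityʳ k) ⟩
    fromℕ (2 ℕ.^ k)           ≈⟨ 2^-fromℕ k ⟨
    2^ (fromℕ k)              ≤⟨ ≤log⇒2^≤ 0<x k≤l ⟩
    x                         ∎)
    where open ≤-R
  ... | -[1+ k ] | _ = inj₁ ≡.refl

-- Guarantees with a budget of failures, for certainty and for probability.

-- Holds k P? x: x satisfies P except with probability at most k units, the unit
-- being chosen by the instance (Identity admits no failure at all).
record Guarantee {M : Set → Set} (monad : RawMonad M) : Set₁ where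
  open RawMonad monad
  field
    Holds      : {A : Set} {P : A → Set} → ℕ → Decidable P → M A → Set
    pure-holds : ∀ {A : Set} {P : A → Set} (P? : Decidable P) {a} → P a → Holds 0 P? (pure a)
    bind-holds : ∀ {A B : Set} {P : A → Set} {Q : B → Set} (P? : Decidable P) (Q? : Decidable Q) j k {x f} →
                 Holds j P? x → (∀ a → P a → Holds k Q? (f a)) → Holds (j ℕ.+ k) Q? (x >>= f)

certainty : Guarantee Identity.monad
certainty = record
  { Holds      = λ {_} {P} _ _ x → P (runIdentity x)
  ; pure-holds = λ _ p → p
  ; bind-holds = λ _ _ _ _ p q → q _ p
  }

module Likelihood (ℛ : Reals) where
  open Reals ℛ
  open Probability ℛ
  open OrderedField ℛ
  open Algebra.Solver.Ring.NaturalCoefficients.Default CR.commutativeSemiring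
    using (solve; _:=_; _:+_; _:*_; con)

  module _ {A : Set} {P : A → Set} (P? : Decidable P) where

    -- This is `Pr` freed from total mass 1, so that induction over the list of outcomes is
    -- possible.
    weight : List (ℝ × A) → ℝ
    weight xs = mass (filter (P? ∘ proj₂) xs)

    weight-accept : ∀ {w a} xs → P a → weight ((w , a) ∷ xs) ≈ w + weight xs
    weight-accept xs p = CR.reflexive (≡.cong mass (filter-accept (P? ∘ proj₂) p))

    weight-reject : ∀ {w a} xs → ¬ P a → weight ((w , a) ∷ xs) ≈ weight xs
    weight-reject xs ¬p = CR.reflexive (≡.cong mass (filter-reject (P? ∘ proj₂) ¬p))

    weight-++ : ∀ xs ys → weight (xs ++ ys) ≈ weight xs + weight ys
    weight-++ xs ys = CR.trans (CR.reflexive (≡.cong mass (filter-++ (P? ∘ proj₂) xs ys))) (mass-++ (filter (P? ∘ proj₂) xs) _)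

    weight-scale : ∀ w xs → weight (scale w xs) ≈ w * weight xs
    weight-scale w [] = CR.sym (CR.zeroʳ w)
    weight-scale w ((v , a) ∷ xs) with P? a
    ... | yes _ = CR.trans (CR.+-congˡ (weight-scale w xs)) (CR.sym (CR.distribˡ w v _))
    ... | no  _ = weight-scale w xs

    weight-nonneg : ∀ {xs} → All (λ wa → 0# ≤ proj₁ wa) xs → 0# ≤ weight xs
    weight-nonneg [] = O.refl
    weight-nonneg {(w , a) ∷ xs} (0≤w ∷ 0≤xs) with P? a
    ... | yes _ = O.trans 0≤w (+-≤ (weight-nonneg 0≤xs))
    ... | no  _ = weight-nonneg 0≤xs

  weight-⊆ : ∀ {A : Set} {P Q : A → Set} (P? : Decidable P) (Q? : Decidable Q) → (∀ a → P a → Q a) →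
             ∀ {xs} → All (λ wa → 0# ≤ proj₁ wa) xs → weight P? xs ≤ weight Q? xs
  weight-⊆ P? Q? P⊆Q [] = O.refl
  weight-⊆ P? Q? P⊆Q {(w , a) ∷ xs} (0≤w ∷ 0≤xs) with P? a | Q? a
  ... | yes _ | yes _ = +-monoʳ-≤ w (weight-⊆ P? Q? P⊆Q 0≤xs)
  ... | yes p | no ¬q with () ← ¬q (P⊆Q a p)
  ... | no  _ | yes _ = O.trans (weight-⊆ P? Q? P⊆Q 0≤xs) (O.≤-respʳ-≈ (CR.+-comm _ w) (+-≤ 0≤w))
  ... | no  _ | no  _ = weight-⊆ P? Q? P⊆Q 0≤xs

  Pr-⊆ : ∀ {A : Set} {P Q : A → Set} (P? : Decidable P) (Q? : Decidable Q) → (∀ a → P a → Q a) →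
         ∀ d → Pr P? d ≤ Pr Q? d
  Pr-⊆ P? Q? P⊆Q d = weight-⊆ P? Q? P⊆Q (nonneg d)

  Pr-return : ∀ {A : Set} {P : A → Set} (P? : Decidable P) {a} → P a → Pr P? (return a) ≈ 1#
  Pr-return P? p = CR.trans (weight-accept P? [] p) (CR.+-identityʳ 1#)

  module _ {A B : Set} {P : A → Set} {Q : B → Set} (P? : Decidable P) (Q? : Decidable Q)
           (f : A → Distribution B) {κ : ℝ} (0≤κ : 0# ≤ κ) (P⇒Q : ∀ a → P a → 1# ≤ Pr Q? (f a) + κ) where

    -- A union bound: an outcome in `P` of weight `w` loses at most `κ * w` when passed through `f`,
    -- and an outcome outside `P` contributes nothing on the left. The function `g` stands for the
    -- local `step` of `bind`, which cannot be named here.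
    weight-concatMap : {g : ℝ × A → List (ℝ × B)} → (∀ w a → g (w , a) ≡ scale w (outcomes (f a))) →
                       ∀ {xs} → All (λ wa → 0# ≤ proj₁ wa) xs →
                       weight P? xs ≤ weight Q? (concatMap g xs) + κ * mass xs
    weight-concatMap g≡ [] = O.reflexive (CR.sym (CR.trans (CR.+-identityˡ _) (CR.zeroʳ κ)))
    weight-concatMap {g} g≡ {(w , a) ∷ xs} (0≤w ∷ 0≤xs) = begin
      weight P? ((w , a) ∷ xs)
        ≤⟨ head (P? a) ⟩
      w * (Pr Q? (f a) + κ) + weight P? xs
        ≤⟨ +-monoʳ-≤ _ (weight-concatMap g≡ 0≤xs) ⟩
      w * (Pr Q? (f a) + κ) + (weight Q? (concatMap g xs) + κ * mass xs)
        ≈⟨ solve 5 (λ w p k r m → w :* (p :+ k) :+ (r :+ k :* m) := w :* p :+ r :+ k :* (w :+ m)) CR.refl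
             w (Pr Q? (f a)) κ (weight Q? (concatMap g xs)) (mass xs) ⟩
      w * Pr Q? (f a) + weight Q? (concatMap g xs) + κ * (w + mass xs)
        ≈⟨ CR.+-congʳ (CR.+-congʳ (weight-scale Q? w (outcomes (f a)))) ⟨
      weight Q? (scale w (outcomes (f a))) + weight Q? (concatMap g xs) + κ * (w + mass xs)
        ≡⟨ ≡.cong (λ ys → weight Q? ys + weight Q? (concatMap g xs) + κ * (w + mass xs)) (g≡ w a) ⟨
      weight Q? (g (w , a)) + weight Q? (concatMap g xs) + κ * (w + mass xs)
        ≈⟨ CR.+-congʳ (weight-++ Q? (g (w , a)) (concatMap g xs)) ⟨
      weight Q? (concatMap g ((w , a) ∷ xs)) + κ * mass ((w , a) ∷ xs) ∎
      where
      open ≤-R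
      0≤Pr+κ : 0# ≤ Pr Q? (f a) + κ
      0≤Pr+κ = O.trans (weight-nonneg Q? (nonneg (f a))) (+-≤ 0≤κ)
      head : Dec (P a) → weight P? ((w , a) ∷ xs) ≤ w * (Pr Q? (f a) + κ) + weight P? xs
      head (yes p) = begin
        weight P? ((w , a) ∷ xs)              ≈⟨ weight-accept P? xs p ⟩
        w + weight P? xs                      ≈⟨ CR.+-congʳ (CR.*-identityʳ w) ⟨
        w * 1# + weight P? xs                 ≤⟨ +-monoˡ-≤ _ (*-monoʳ-≤ 0≤w (P⇒Q a p)) ⟩
        w * (Pr Q? (f a) + κ) + weight P? xs  ∎
      head (no ¬p) = begin
        weight P? ((w , a) ∷ xs)              ≈⟨ weight-reject P? xs ¬p ⟩
        weight P? xs                          ≤⟨ +-≤ (*-nonneg 0≤w 0≤Pr+κ) ⟩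
        weight P? xs + w * (Pr Q? (f a) + κ)  ≈⟨ CR.+-comm _ _ ⟩
        w * (Pr Q? (f a) + κ) + weight P? xs  ∎

    Pr-bind : ∀ d → Pr P? d ≤ Pr Q? (bind d f) + κ
    Pr-bind d = O.≤-respʳ-≈ (CR.+-congˡ (CR.trans (CR.*-congˡ (total d)) (CR.*-identityʳ κ)))
                            (weight-concatMap (λ _ _ → ≡.refl) (nonneg d))

  -- Moving the failure term to the right-hand side avoids subtraction and makes sequencing add the
  -- units.
  likelihood : ∀ {δ} → 0# ≤ δ → Guarantee monad
  likelihood {δ} 0≤δ = record
    { Holds      = λ k P? d → 1# ≤ Pr P? d + fromℕ k * δ
    ; pure-holds = λ P? p → O.trans (O.reflexive (CR.sym (Pr-return P? p))) (+-≤ (*-nonneg (0≤fromℕ 0) 0≤δ))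
    ; bind-holds = λ P? Q? j k {x} {f} hx hf → begin
        1#                                                      ≤⟨ hx ⟩
        Pr P? x + fromℕ j * δ
          ≤⟨ +-monoˡ-≤ _ (Pr-bind P? Q? f (*-nonneg (0≤fromℕ k) 0≤δ) hf x) ⟩
        Pr Q? (bind x f) + fromℕ k * δ + fromℕ j * δ
          ≈⟨ solve 4 (λ p j k d → p :+ k :* d :+ j :* d := p :+ (j :+ k) :* d)
               CR.refl (Pr Q? (bind x f)) (fromℕ j) (fromℕ k) δ ⟩
        Pr Q? (bind x f) + (fromℕ j + fromℕ k) * δ              ≈⟨ CR.+-congˡ (CR.*-congʳ (fromℕ-+ j k)) ⟨
        Pr Q? (bind x f) + fromℕ (j ℕ.+ k) * δ                  ∎
    }
    where open ≤-R

-- Palette, time and failure count of the whole recursion.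

module Recursion (ℛ : Reals) (impl : Implementation) where
  open Reals ℛ
  open EdgeColoring ℛ
  open OrderedField ℛ
  open Implementation impl
  open Algebra.Solver.Ring.NaturalCoefficients.Default CR.commutativeSemiring
    using (solve; _:=_; _:+_; _:*_; con)

  half-graph : ∀ {N} → Graph N → Bool → Graph N
  half-graph G = part G (proj₁ (split G))

  nodeRate : ℕ
  nodeRate = proj₁ overhead-linear ℕ.+ proj₁ split-linear

  node-time : ∀ {N} (G : Graph N) → 1 ℕ.≤ size G → overhead G ℕ.+ proj₂ (split G) ℕ.≤ nodeRate ℕ.* size G
  node-time G 1≤m = ℕ.≤-trans (ℕ.+-mono-≤ (proj₂ overhead-linear G 1≤m) (proj₂ split-linear G 1≤m))
    (ℕ.≤-reflexive (≡.sym (ℕ.*-distribʳ-+ (size G) (proj₁ overhead-linear) _)))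

  module _ (A : ℝ) where

    -- The two halves partition the edges, so each of the `suc h` levels costs `nodeRate` per edge
    -- and the leaves cost `A` per edge.
    rate : ℕ → ℝ
    rate h = A + fromℕ (suc h) * fromℕ nodeRate

    -- The palette clause is tight at a leaf, where it reads `Δ + 1 + 2 = Δ + 3`. Two copies bring a
    -- slack of 4 on the left; the maximum degrees of the halves exceed `Δ` by at most 2 in total,
    -- so a slack of 2 survives.
    Good : ∀ {N} → ℕ → Graph N → Coloring N × ℕ → Set
    Good h G (φ , t) =
      IsProperColoring G (palette φ) (color φ) ×
      palette φ ℕ.+ 2 ℕ.≤ maxDegree G ℕ.+ 3 ℕ.* 2 ℕ.^ h ×
      fromℕ t ≤ rate h * fromℕ (size G)

    good? : ∀ {N} h (G : Graph N) → Decidable (Good h G)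
    good? h G (φ , t) =
      isProperColoring? G (palette φ) (color φ) ×-dec
      palette φ ℕ.+ 2 ℕ.≤? maxDegree G ℕ.+ 3 ℕ.* 2 ℕ.^ h ×-dec
      fromℕ t ≤? rate h * fromℕ (size G)

    Leaf : ∀ {N} → Graph N → (Edge N → ℕ) × ℕ → Set
    Leaf G = WithinTime G (A * fromℕ (size G))

    leaf? : ∀ {N} (G : Graph N) → Decidable (Leaf G)
    leaf? G = withinTime? G (A * fromℕ (size G))

    leaf-good : ∀ {N} (G : Graph N) → 1 ℕ.≤ size G → ∀ f t → Leaf G (f , t) →
                Good 0 G (record { palette = suc (maxDegree G) ; color = f } , overhead G ℕ.+ t)
    leaf-good G 1≤m f t (proper , t≤) = proper , ℕ.≤-reflexive (≡.sym (ℕ.+-suc (maxDegree G) 2)) , (begin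
      fromℕ (overhead G ℕ.+ t)                            ≈⟨ fromℕ-+ (overhead G) t ⟩
      fromℕ (overhead G) + fromℕ t
        ≤⟨ +-mono-≤ (fromℕ-mono (ℕ.≤-trans (ℕ.m≤m+n (overhead G) _) (node-time G 1≤m))) t≤ ⟩
      fromℕ (nodeRate ℕ.* size G) + A * fromℕ (size G)    ≈⟨ CR.+-congʳ (fromℕ-* nodeRate (size G)) ⟩
      fromℕ nodeRate * fromℕ (size G) + A * fromℕ (size G)
        ≈⟨ solve 3 (λ b m a → b :* m :+ a :* m := (a :+ (con 1 :+ con 0) :* b) :* m)
               CR.refl (fromℕ nodeRate) (fromℕ (size G)) A ⟩
      rate 0 * fromℕ (size G) ∎)
      where open ≤-R

    node-good : ∀ {N} h (G : Graph N) → 1 ℕ.≤ size G → ∀ φ₁ t₁ φ₂ t₂ →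
                Good h (half-graph G true) (φ₁ , t₁) → Good h (half-graph G false) (φ₂ , t₂) →
                Good (suc h) G (merge (proj₁ (split G)) φ₁ φ₂ , overhead G ℕ.+ proj₂ (split G) ℕ.+ t₁ ℕ.+ t₂)
    node-good h G 1≤m φ₁ t₁ φ₂ t₂ (proper₁ , p₁≤ , t₁≤) (proper₂ , p₂≤ , t₂≤) =
      merge-proper G (proj₁ (split G)) φ₁ φ₂ proper₁ proper₂ , ℕ.+-cancelʳ-≤ 2 _ _ palette≤ , time≤
      where
      G₁ = half-graph G true
      G₂ = half-graph G false
      -- The two maxima may be attained at different vertices, so each half is bounded on its own.
      Δ₁+Δ₂≤ : maxDegree G₁ ℕ.+ maxDegree G₂ ℕ.≤ maxDegree G ℕ.+ 2
      Δ₁+Δ₂≤ = ℕ.*-cancelˡ-≤ 2 (begin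
        2 ℕ.* (maxDegree G₁ ℕ.+ maxDegree G₂)           ≡⟨ ℕ.*-distribˡ-+ 2 (maxDegree G₁) _ ⟩
        2 ℕ.* maxDegree G₁ ℕ.+ 2 ℕ.* maxDegree G₂       ≤⟨ ℕ.+-mono-≤ (upper true) (upper false) ⟩
        maxDegree G ℕ.+ 2 ℕ.+ (maxDegree G ℕ.+ 2)       ≡⟨ ≡.cong (maxDegree G ℕ.+ 2 ℕ.+_) (ℕ.+-identityʳ _) ⟨
        2 ℕ.* (maxDegree G ℕ.+ 2)                       ∎)
        where
        open ℕ.≤-Reasoning
        upper = maxDegree-part-upper G (proj₁ (split G)) (split-degrees G)
      palette≤ : palette φ₁ ℕ.+ palette φ₂ ℕ.+ 2 ℕ.+ 2 ℕ.≤ maxDegree G ℕ.+ 3 ℕ.* 2 ℕ.^ suc h ℕ.+ 2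
      palette≤ = begin
        palette φ₁ ℕ.+ palette φ₂ ℕ.+ 2 ℕ.+ 2
          ≡⟨ S.solve 2 (λ p q → p S.:+ q S.:+ S.con 2 S.:+ S.con 2 S.:= p S.:+ S.con 2 S.:+ (q S.:+ S.con 2))
                 ≡.refl (palette φ₁) (palette φ₂) ⟩
        palette φ₁ ℕ.+ 2 ℕ.+ (palette φ₂ ℕ.+ 2)
          ≤⟨ ℕ.+-mono-≤ p₁≤ p₂≤ ⟩
        maxDegree G₁ ℕ.+ 3 ℕ.* 2 ℕ.^ h ℕ.+ (maxDegree G₂ ℕ.+ 3 ℕ.* 2 ℕ.^ h)
          ≡⟨ S.solve 3 (λ p q x → p S.:+ S.con 3 S.:* x S.:+ (q S.:+ S.con 3 S.:* x) S.:= p S.:+ q S.:+ S.con 3 S.:* (S.con 2 S.:* x))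
                 ≡.refl (maxDegree G₁) (maxDegree G₂) (2 ℕ.^ h) ⟩
        maxDegree G₁ ℕ.+ maxDegree G₂ ℕ.+ 3 ℕ.* 2 ℕ.^ suc h
          ≤⟨ ℕ.+-monoˡ-≤ _ Δ₁+Δ₂≤ ⟩
        maxDegree G ℕ.+ 2 ℕ.+ 3 ℕ.* 2 ℕ.^ suc h
          ≡⟨ S.solve 2 (λ p x → p S.:+ S.con 2 S.:+ x S.:= p S.:+ x S.:+ S.con 2)
                 ≡.refl (maxDegree G) (3 ℕ.* 2 ℕ.^ suc h) ⟩
        maxDegree G ℕ.+ 3 ℕ.* 2 ℕ.^ suc h ℕ.+ 2 ∎
        where
        open ℕ.≤-Reasoning
        module S = +-*-Solver
      own = overhead G ℕ.+ proj₂ (split G)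
      m₁ m₂ r b : ℝ
      m₁ = fromℕ (size G₁)
      m₂ = fromℕ (size G₂)
      r  = fromℕ (suc h)
      b  = fromℕ nodeRate
      m≈ : fromℕ (size G) ≈ m₁ + m₂
      m≈ = CR.trans (CR.reflexive (≡.cong fromℕ (≡.sym (size-parts G (proj₁ (split G)) (split-balanced G))))) (fromℕ-+ (size G₁) (size G₂))
      time≤ : fromℕ (overhead G ℕ.+ proj₂ (split G) ℕ.+ t₁ ℕ.+ t₂) ≤ rate (suc h) * fromℕ (size G)
      time≤ = begin
        fromℕ (overhead G ℕ.+ proj₂ (split G) ℕ.+ t₁ ℕ.+ t₂)
          ≈⟨ CR.trans (fromℕ-+ (own ℕ.+ t₁) t₂) (CR.+-congʳ (fromℕ-+ own t₁)) ⟩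
        fromℕ (overhead G ℕ.+ proj₂ (split G)) + fromℕ t₁ + fromℕ t₂
          ≤⟨ +-mono-≤ (+-mono-≤ (fromℕ-mono (node-time G 1≤m)) t₁≤) t₂≤ ⟩
        fromℕ (nodeRate ℕ.* size G) + rate h * m₁ + rate h * m₂
          ≈⟨ CR.+-congʳ (CR.+-congʳ (CR.trans (fromℕ-* nodeRate (size G)) (CR.*-congˡ m≈))) ⟩
        b * (m₁ + m₂) + (A + r * b) * m₁ + (A + r * b) * m₂
          ≈⟨ solve 5 (λ b x y a r → b :* (x :+ y) :+ (a :+ r :* b) :* x :+ (a :+ r :* b) :* y := (a :+ (con 1 :+ r) :* b) :* (x :+ y))
                 CR.refl b m₁ m₂ A r ⟩
        (A + (1# + r) * b) * (m₁ + m₂)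
          ≈⟨ CR.*-congˡ m≈ ⟨
        rate (suc h) * fromℕ (size G) ∎
        where open ≤-R

    module _ {M : Set → Set} {monad : RawMonad M} (logic : Guarantee monad)
             (base : ∀ {N} → Graph N → M ((Edge N → ℕ) × ℕ))
             (Inv : ∀ {N} → ℕ → Graph N → Set)
             (nonempty : ∀ {N} h (G : Graph N) → Inv h G → 1 ℕ.≤ size G)
             (descend : ∀ {N} h (G : Graph N) → Inv (suc h) G → ∀ b → Inv h (half-graph G b))
             (leaf : ∀ {N} (G : Graph N) → Inv 0 G → Guarantee.Holds logic 1 (leaf? G) (base G)) where
      open Guarantee logic
      open Procedure impl monad base

      -- Only leaves consume failure units, one each; splitting and merging are certain.
      edgeColoring-good : ∀ {N} h (G : Graph N) → Inv h G → Holds (2 ℕ.^ h) (good? h G) (edgeColoring h G)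
      edgeColoring-good zero G inv = bind-holds (leaf? G) (good? 0 G) 1 0 (leaf G inv)
        λ { (f , t) good → pure-holds (good? 0 G) (leaf-good G (nonempty 0 G inv) f t good) }
      edgeColoring-good (suc h) G inv =
        bind-holds (good? h (half-graph G true)) (good? (suc h) G) (2 ℕ.^ h) _
          (edgeColoring-good h (half-graph G true) (descend h G inv true))
          -- The `0` belongs to the final `pure`: `2 ^ h + (2 ^ h + 0)` is literally what
          -- `2 ^ suc h` unfolds to.
          λ { (φ₁ , t₁) good₁ → bind-holds (good? h (half-graph G false)) (good? (suc h) G) (2 ℕ.^ h) 0
                (edgeColoring-good h (half-graph G false) (descend h G inv false))
                λ { (φ₂ , t₂) good₂ → pure-holds (good? (suc h) G)
                      (node-good h G (nonempty (suc h) G inv) φ₁ t₁ φ₂ t₂ good₁ good₂) } }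

-- How degrees and edge counts evolve along the recursion.

module Invariants (impl : Implementation) where
  open Implementation impl
  open +-*-Solver
  open ℕ.≤-Reasoning

  private
    child : ∀ {N} → Graph N → Bool → Graph N
    child G = part G (proj₁ (split G))

  -- R is the maximum degree of the input graph, H the recursion depth, and h the
  -- number of rounds that G still has to go through.
  record DegreeBounds {N} (q R H h : ℕ) (G : Graph N) : Set where
    field
      lower : q ℕ.* 2 ℕ.^ h ℕ.≤ maxDegree G ℕ.+ 2
      upper : 2 ℕ.^ H ℕ.* maxDegree G ℕ.≤ 2 ℕ.^ h ℕ.* R ℕ.+ 2 ℕ.* 2 ℕ.^ H
  open DegreeBounds public

  degreeBounds-root : ∀ {N q H} {G : Graph N} → q ℕ.* 2 ℕ.^ H ℕ.≤ maxDegree G ℕ.+ 2 →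
                      DegreeBounds q (maxDegree G) H H G
  degreeBounds-root low = record { lower = low ; upper = ℕ.m≤m+n _ _ }

  -- The offsets 2 come from the fixed points of `x/2 - 1` and `x/2 + 1`: in each round `Δ + 2`
  -- loses at most a factor 2 and `Δ - 2` at least one. Both bounds are cleared of denominators.
  degreeBounds-child : ∀ {N q R H} h (G : Graph N) → DegreeBounds q R H (suc h) G →
                       ∀ b → DegreeBounds q R H h (child G b)
  degreeBounds-child {N} {q} {R} {H} h G bounds b = record
    { lower = ℕ.*-cancelˡ-≤ 2 (begin
        2 ℕ.* (q ℕ.* x)                ≡⟨ solve 2 (λ q x → con 2 :* (q :* x) := q :* (con 2 :* x)) ≡.refl q x ⟩
        q ℕ.* 2 ℕ.^ suc h              ≤⟨ lower bounds ⟩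
        maxDegree G ℕ.+ 2              ≤⟨ ℕ.+-monoˡ-≤ 2 (maxDegree-part-lower G side (split-degrees G) b) ⟩
        2 ℕ.* d ℕ.+ 2 ℕ.+ 2
          ≡⟨ solve 1 (λ d → con 2 :* d :+ con 2 :+ con 2 := con 2 :* (d :+ con 2)) ≡.refl d ⟩
        2 ℕ.* (d ℕ.+ 2)                ∎)
    ; upper = ℕ.*-cancelˡ-≤ 2 (begin
        2 ℕ.* (y ℕ.* d)
          ≡⟨ solve 2 (λ y d → con 2 :* (y :* d) := y :* (con 2 :* d)) ≡.refl y d ⟩
        y ℕ.* (2 ℕ.* d)                          ≤⟨ ℕ.*-monoʳ-≤ y (maxDegree-part-upper G side (split-degrees G) b) ⟩
        y ℕ.* (maxDegree G ℕ.+ 2)                ≡⟨ ℕ.*-distribˡ-+ y (maxDegree G) 2 ⟩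
        y ℕ.* maxDegree G ℕ.+ y ℕ.* 2            ≤⟨ ℕ.+-monoˡ-≤ (y ℕ.* 2) (upper bounds) ⟩
        2 ℕ.* x ℕ.* R ℕ.+ 2 ℕ.* y ℕ.+ y ℕ.* 2
          ≡⟨ solve 3 (λ x y r → con 2 :* x :* r :+ con 2 :* y :+ y :* con 2 := con 2 :* (x :* r :+ con 2 :* y))
               ≡.refl x y R ⟩
        2 ℕ.* (x ℕ.* R ℕ.+ 2 ℕ.* y)              ∎)
    }
    where
    side = proj₁ (split G)
    x = 2 ℕ.^ h
    y = 2 ℕ.^ H
    d = maxDegree (child G b)

  degreeBounds⇒maxDegree : ∀ {N q R H h} {G : Graph N} → DegreeBounds q R H h G → q ℕ.≤ maxDegree G ℕ.+ 2
  degreeBounds⇒maxDegree {q = q} {h = h} bounds =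
    ℕ.≤-trans (ℕ.m≤m*n q (2 ℕ.^ h) {{ℕ.m^n≢0 2 h}}) (lower bounds)

  degreeBounds⇒1≤maxDegree : ∀ {N q R H h} {G : Graph N} → 3 ℕ.≤ q → DegreeBounds q R H h G → 1 ℕ.≤ maxDegree G
  degreeBounds⇒1≤maxDegree 3≤q bounds = ℕ.+-cancelʳ-≤ 2 1 _ (ℕ.≤-trans 3≤q (degreeBounds⇒maxDegree bounds))

  degreeBounds-leaf : ∀ {N q R H} {G : Graph N} → DegreeBounds q R H 0 G →
                      2 ℕ.^ H ℕ.* maxDegree G ℕ.≤ R ℕ.+ 2 ℕ.* 2 ℕ.^ H
  degreeBounds-leaf {R = R} {H} bounds = ≡.subst (λ r → _ ℕ.≤ r ℕ.+ 2 ℕ.* 2 ℕ.^ H) (ℕ.*-identityˡ R) (upper bounds)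

  -- heavy says that n/2^(H-h) ≤ 2 (size G + 1), where n is the order of the input.
  record Spread {N} (n H h : ℕ) (G : Graph N) : Set where
    field
      noIsolated : NoIsolatedVertices G
      heavy      : n ℕ.* 2 ℕ.^ h ℕ.≤ 2 ℕ.* 2 ℕ.^ H ℕ.* (size G ℕ.+ 1)
  open Spread public

  -- Without isolated vertices `n` is at most twice the number of edges, a quantity that the
  -- splitting halves evenly.
  spread-root : ∀ {N H} {G : Graph N} → NoIsolatedVertices G → Spread (order G) H H G
  spread-root {H = H} {G} noIso = record
    { noIsolated = noIso
    ; heavy      = begin
        order G ℕ.* y                     ≤⟨ ℕ.*-monoˡ-≤ y (order≤2*size G noIso) ⟩
        2 ℕ.* size G ℕ.* y                ≤⟨ ℕ.m≤m+n _ _ ⟩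
        2 ℕ.* size G ℕ.* y ℕ.+ 2 ℕ.* y
          ≡⟨ solve 2 (λ m y → con 2 :* m :* y :+ con 2 :* y := con 2 :* y :* (m :+ con 1))
               ≡.refl (size G) y ⟩
        2 ℕ.* y ℕ.* (size G ℕ.+ 1)        ∎
    }
    where y = 2 ℕ.^ H

  -- Tracking `size + 1` makes the rounding harmless: `size ≤ 2 m + 1` is the same as
  -- `size + 1 ≤ 2 (m + 1)`.
  spread-child : ∀ {N n H} h (G : Graph N) → Spread n H (suc h) G → ∀ b → Spread n H h (child G b)
  spread-child {n = n} {H} h G spread b = record
    { noIsolated = part-noIsolated G (proj₁ (split G)) b
    ; heavy      = ℕ.*-cancelˡ-≤ 2 (begin
        2 ℕ.* (n ℕ.* 2 ℕ.^ h)
          ≡⟨ solve 2 (λ n x → con 2 :* (n :* x) := n :* (con 2 :* x)) ≡.refl n (2 ℕ.^ h) ⟩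
        n ℕ.* 2 ℕ.^ suc h                       ≤⟨ heavy spread ⟩
        2 ℕ.* y ℕ.* (size G ℕ.+ 1)
          ≤⟨ ℕ.*-monoʳ-≤ (2 ℕ.* y) (ℕ.+-monoˡ-≤ 1 (size-part-lower G (proj₁ (split G)) (split-balanced G) b)) ⟩
        2 ℕ.* y ℕ.* (2 ℕ.* m ℕ.+ 1 ℕ.+ 1)
          ≡⟨ solve 2 (λ y m → con 2 :* y :* (con 2 :* m :+ con 1 :+ con 1) := con 2 :* (con 2 :* y :* (m :+ con 1)))
               ≡.refl y m ⟩
        2 ℕ.* (2 ℕ.* y ℕ.* (m ℕ.+ 1))           ∎)
    }
    where
    y = 2 ℕ.^ H
    m = size (child G b)

  -- Of the two extra doublings in `2 + H`, one comes from `n ≤ 2 size` at the root, the other from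
  -- `size + 1 ≤ 2 size` at the leaf.
  spread-leaf : ∀ {N n H} {G : Graph N} → Spread n H 0 G → 1 ℕ.≤ size G →
                n ℕ.≤ 2 ℕ.^ (2 ℕ.+ H) ℕ.* (order G ℕ.* order G)
  spread-leaf {n = n} {H} {G} spread 1≤m = begin
    n                                        ≡⟨ ℕ.*-identityʳ n ⟨
    n ℕ.* 1                                  ≤⟨ heavy spread ⟩
    2 ℕ.* y ℕ.* (size G ℕ.+ 1)               ≤⟨ ℕ.*-monoʳ-≤ (2 ℕ.* y) (ℕ.+-monoʳ-≤ (size G) 1≤m) ⟩
    2 ℕ.* y ℕ.* (size G ℕ.+ size G)
      ≡⟨ solve 2 (λ y m → con 2 :* y :* (m :+ m) := con 2 :* (con 2 :* y) :* m) ≡.refl y (size G) ⟩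
    2 ℕ.^ (2 ℕ.+ H) ℕ.* size G               ≤⟨ ℕ.*-monoʳ-≤ (2 ℕ.^ (2 ℕ.+ H)) (size≤order² G) ⟩
    2 ℕ.^ (2 ℕ.+ H) ℕ.* (order G ℕ.* order G) ∎
    where y = 2 ℕ.^ H

-- The chosen depth, and the logarithm of a small leaf.

module Bounds (ℛ : Reals) where
  open Reals ℛ
  open EdgeColoring ℛ
  open OrderedField ℛ
  open ≤-R
  open Algebra.Solver.Ring.NaturalCoefficients.Default CR.commutativeSemiring
    using (solve; _:=_; _:+_; _:*_; con)

  0<⁻¹ : ∀ {x} → 0# < x → 0# < x ⁻¹
  0<⁻¹ {x} 0<x = 0≤⁻¹ 0<x , λ 0≈x⁻¹ → 0≉1 (begin-equality
    0#          ≈⟨ CR.zeroʳ x ⟨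
    x * 0#      ≈⟨ CR.*-congˡ 0≈x⁻¹ ⟩
    x * x ⁻¹    ≈⟨ *-inv 0<x ⟩
    1#          ∎)

  fromℕ-reflects-≤ : ∀ {m n} → fromℕ m ≤ fromℕ n → m ℕ.≤ n
  fromℕ-reflects-≤ {m} {n} fm≤fn with m ℕ.≤? n
  ... | yes m≤n = m≤n
  ... | no  m≰n = ⊥-elim (0≉1 (O.antisym 0≤1 (+-cancelʳ-≤ (fromℕ n) (begin
    1# + fromℕ n    ≤⟨ fromℕ-mono (ℕ.≰⇒> m≰n) ⟩
    fromℕ m         ≤⟨ fm≤fn ⟩
    fromℕ n         ≈⟨ CR.+-identityˡ _ ⟨
    0# + fromℕ n    ∎))))

  -- `3 ≤ q` serves the palette bound; `q ≤ 4` serves the leaf degree and the case of depth 0.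
  module Depth {q Δ : ℕ} {ε : ℝ} (3≤q : 3 ℕ.≤ q) (q≤4 : q ℕ.≤ 4)
               (1≤Δ : 1 ℕ.≤ Δ) (1/Δ≤ε : 1# / fromℕ Δ ≤ ε) (ε<1 : ε < 1#) where

    H : ℕ
    H = depth (ε * fromℕ Δ / fromℕ q)

    1≤εΔ : 1# ≤ ε * fromℕ Δ
    1≤εΔ = /≤⇒≤* (0<fromℕ 1≤Δ) 1/Δ≤ε

    0<ε : 0# < ε
    0<ε = <-≤-trans (O.≤-respʳ-≈ (CR.sym (CR.*-identityˡ _)) (proj₁ 0<Δ⁻¹) , λ 0≈ → proj₂ 0<Δ⁻¹ (CR.trans 0≈ (CR.*-identityˡ _))) 1/Δ≤ε
      where 0<Δ⁻¹ = 0<⁻¹ (0<fromℕ 1≤Δ)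

    εΔ≤Δ : ε * fromℕ Δ ≤ fromℕ Δ
    εΔ≤Δ = O.≤-respʳ-≈ (CR.*-identityˡ _) (*-monoˡ-≤ (0≤fromℕ Δ) (proj₁ ε<1))

    -- `Δ = 1` would give `1 ≤ ε`. The value 2 is what depth 0 requires, through `q ≤ 4 ≤ Δ + 2`.
    2≤Δ : 2 ℕ.≤ Δ
    2≤Δ with 2 ℕ.≤? Δ
    ... | yes 2≤Δ = 2≤Δ
    ... | no  2≰Δ = ⊥-elim (proj₂ ε<1 (O.antisym (proj₁ ε<1) (begin
      1#              ≤⟨ 1≤εΔ ⟩
      ε * fromℕ Δ     ≤⟨ *-monoʳ-≤ (proj₁ 0<ε) (fromℕ-mono (ℕ.≤-pred (ℕ.≰⇒> 2≰Δ))) ⟩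
      ε * fromℕ 1     ≈⟨ CR.*-congˡ fromℕ-1 ⟩
      ε * 1#          ≈⟨ CR.*-identityʳ ε ⟩
      ε               ∎)))

    1≤1/ε : 1# ≤ 1# / ε
    1≤1/ε = *≤⇒≤/ 0<ε (O.≤-respˡ-≈ (CR.sym (CR.*-identityˡ ε)) (proj₁ ε<1))

    private
      0<q : 0# < fromℕ q
      0<q = 0<fromℕ (ℕ.≤-trans (s≤s z≤n) 3≤q)

      0<x : 0# < ε * fromℕ Δ / fromℕ q
      0<x = *-pos (*-pos 0<ε (0<fromℕ 1≤Δ)) (0<⁻¹ 0<q)

      q2^H : H ≡ 0 ⊎ fromℕ (q ℕ.* 2 ℕ.^ H) ≤ ε * fromℕ Δ
      q2^H with depth-lower 0<x
      ... | inj₁ H≡0    = inj₁ H≡0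
      ... | inj₂ 2^H≤x  = inj₂ (begin
        fromℕ (q ℕ.* 2 ℕ.^ H)        ≈⟨ CR.trans (fromℕ-* q (2 ℕ.^ H)) (CR.*-comm _ _) ⟩
        fromℕ (2 ℕ.^ H) * fromℕ q    ≤⟨ ≤/⇒*≤ 0<q 2^H≤x ⟩
        ε * fromℕ Δ                  ∎)

    q2^H≤Δ+2 : q ℕ.* 2 ℕ.^ H ℕ.≤ Δ ℕ.+ 2
    q2^H≤Δ+2 with q2^H
    ... | inj₁ H≡0 = ℕ.≤-trans (ℕ.≤-reflexive (≡.trans (≡.cong (λ h → q ℕ.* 2 ℕ.^ h) H≡0) (ℕ.*-identityʳ q)))
                       (ℕ.≤-trans q≤4 (ℕ.+-monoˡ-≤ 2 2≤Δ))
    ... | inj₂ ≤εΔ = ℕ.≤-trans (fromℕ-reflects-≤ (O.trans ≤εΔ εΔ≤Δ)) (ℕ.m≤m+n Δ 2)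

    2^H≤εΔ : fromℕ (2 ℕ.^ H) ≤ ε * fromℕ Δ
    2^H≤εΔ with q2^H
    ... | inj₁ H≡0 = begin
      fromℕ (2 ℕ.^ H)    ≡⟨ ≡.cong (λ h → fromℕ (2 ℕ.^ h)) H≡0 ⟩
      fromℕ 1            ≈⟨ fromℕ-1 ⟩
      1#                 ≤⟨ 1≤εΔ ⟩
      ε * fromℕ Δ        ∎
    ... | inj₂ ≤εΔ = O.trans (fromℕ-mono (ℕ.m≤n*m (2 ℕ.^ H) q {{ℕ.>-nonZero (ℕ.≤-trans (s≤s z≤n) 3≤q)}})) ≤εΔ

    -- The summand 2 is the slack of the palette clause, and it is needed exactly at depth 0, where
    -- `3 = 1 + 2` and only `1 ≤ εΔ` is known.
    3*2^H≤εΔ+2 : fromℕ (3 ℕ.* 2 ℕ.^ H) ≤ ε * fromℕ Δ + fromℕ 2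
    3*2^H≤εΔ+2 with q2^H
    ... | inj₁ H≡0 = begin
      fromℕ (3 ℕ.* 2 ℕ.^ H)    ≡⟨ ≡.cong (λ h → fromℕ (3 ℕ.* 2 ℕ.^ h)) H≡0 ⟩
      1# + fromℕ 2             ≤⟨ +-monoˡ-≤ _ 1≤εΔ ⟩
      ε * fromℕ Δ + fromℕ 2    ∎
    ... | inj₂ ≤εΔ = begin
      fromℕ (3 ℕ.* 2 ℕ.^ H)    ≤⟨ fromℕ-mono (ℕ.*-monoˡ-≤ (2 ℕ.^ H) 3≤q) ⟩
      fromℕ (q ℕ.* 2 ℕ.^ H)    ≤⟨ ≤εΔ ⟩
      ε * fromℕ Δ              ≤⟨ +-≤ (0≤fromℕ 2) ⟩
      ε * fromℕ Δ + fromℕ 2    ∎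

    colors : ∀ p → p ℕ.+ 2 ℕ.≤ Δ ℕ.+ 3 ℕ.* 2 ℕ.^ H → fromℕ p ≤ (1# + ε) * fromℕ Δ
    colors p p+2≤ = +-cancelʳ-≤ (fromℕ 2) (begin
      fromℕ p + fromℕ 2                        ≈⟨ fromℕ-+ p 2 ⟨
      fromℕ (p ℕ.+ 2)                          ≤⟨ fromℕ-mono p+2≤ ⟩
      fromℕ (Δ ℕ.+ 3 ℕ.* 2 ℕ.^ H)              ≈⟨ fromℕ-+ Δ _ ⟩
      fromℕ Δ + fromℕ (3 ℕ.* 2 ℕ.^ H)          ≤⟨ +-monoʳ-≤ _ 3*2^H≤εΔ+2 ⟩
      fromℕ Δ + (ε * fromℕ Δ + fromℕ 2)
        ≈⟨ solve 3 (λ d e t → d :+ (e :* d :+ t) := (con 1 :+ e) :* d :+ t) CR.refl (fromℕ Δ) ε (fromℕ 2) ⟩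
      (1# + ε) * fromℕ Δ + fromℕ 2             ∎)

    -- The 10 is `8 + 2`: the depth is maximal, so `εΔ` is at most `2 q 2^H`, hence at most
    -- `8 * 2^H`; the additive 2 in the degree contributes `2 ε`, at most 2.
    leaf-degree : ∀ d → 2 ℕ.^ H ℕ.* d ℕ.≤ Δ ℕ.+ 2 ℕ.* 2 ℕ.^ H → fromℕ d ≤ fromℕ 10 * (1# / ε)
    leaf-degree d 2^Hd≤ = begin
      fromℕ d                      ≤⟨ *≤⇒≤/ 0<ε (*-cancelˡ-≤ 0<M scaled) ⟩
      fromℕ 10 / ε                 ≈⟨ CR.*-congˡ (CR.*-identityˡ _) ⟨
      fromℕ 10 * (1# / ε)          ∎
      where
      M : ℝ
      M = fromℕ (2 ℕ.^ H)
      0<M : 0# < M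
      0<M = 0<fromℕ (ℕ.m^n>0 2 H)
      εΔ≤ : ε * fromℕ Δ ≤ fromℕ 8 * M
      εΔ≤ = begin
        ε * fromℕ Δ                            ≤⟨ /≤⇒≤* 0<q (depth-upper 0<x) ⟩
        fromℕ (2 ℕ.^ suc H) * fromℕ q          ≤⟨ *-monoʳ-≤ (0≤fromℕ (2 ℕ.^ suc H)) (fromℕ-mono q≤4) ⟩
        fromℕ (2 ℕ.^ suc H) * fromℕ 4          ≈⟨ CR.*-congʳ (fromℕ-* 2 (2 ℕ.^ H)) ⟩
        fromℕ 2 * M * fromℕ 4                  ≈⟨ solve 1 (λ m → num 2 :* m :* num 4 := num 8 :* m) CR.refl M ⟩
        fromℕ 8 * M                            ∎
      scaled : M * (fromℕ d * ε) ≤ M * fromℕ 10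
      scaled = begin
        M * (fromℕ d * ε)
          ≈⟨ solve 3 (λ m d e → m :* (d :* e) := e :* (m :* d)) CR.refl M (fromℕ d) ε ⟩
        ε * (M * fromℕ d)                            ≈⟨ CR.*-congˡ (fromℕ-* (2 ℕ.^ H) d) ⟨
        ε * fromℕ (2 ℕ.^ H ℕ.* d)                    ≤⟨ *-monoʳ-≤ (proj₁ 0<ε) (fromℕ-mono 2^Hd≤) ⟩
        ε * fromℕ (Δ ℕ.+ 2 ℕ.* 2 ℕ.^ H)
          ≈⟨ CR.*-congˡ (CR.trans (fromℕ-+ Δ _) (CR.+-congˡ (fromℕ-* 2 (2 ℕ.^ H)))) ⟩
        ε * (fromℕ Δ + fromℕ 2 * M)                  ≈⟨ CR.distribˡ ε _ _ ⟩
        ε * fromℕ Δ + ε * (fromℕ 2 * M)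
          ≤⟨ +-mono-≤ εΔ≤ (*-monoˡ-≤ (*-nonneg (0≤fromℕ 2) (proj₁ 0<M)) (proj₁ ε<1)) ⟩
        fromℕ 8 * M + 1# * (fromℕ 2 * M)
          ≈⟨ solve 1 (λ m → num 8 :* m :+ con 1 :* (num 2 :* m) := m :* num 10) CR.refl M ⟩
        M * fromℕ 10                                 ∎

    H≤log : ∀ {x} → ε * fromℕ Δ ≤ x → fromℕ H ≤ log₂ x
    H≤log εΔ≤x = 2^ℕ≤⇒≤log {H} (O.trans 2^H≤εΔ εΔ≤x)

  -- With s = √order, order ≤ D log n gives s² ≤ D (2 + H) + 4 D s; the last
  -- term is absorbed by s² up to a constant, and log order ≤ 2 s.
  log-order² : ∀ {n ν H : ℕ} {D : ℝ} → 0# ≤ D → 1 ℕ.≤ n → 1 ℕ.≤ ν →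
               n ℕ.≤ 2 ℕ.^ (2 ℕ.+ H) ℕ.* (ν ℕ.* ν) → fromℕ ν ≤ D * log₂ (fromℕ n) →
               let p = fromℕ 4 * D in
               log₂ (fromℕ ν) * log₂ (fromℕ ν) ≤ fromℕ 4 * (p + p * p) * fromℕ (suc H)
  log-order² {n} {ν} {H} {D} 0≤D 1≤n 1≤ν n≤ ν≤ = begin
    L * L                                    ≈⟨ CR.*-cong (halves L) (halves L) ⟨
    (a + a) * (a + a)                        ≈⟨ solve 1 (λ a → (a :+ a) :* (a :+ a) := num 4 :* (a :* a)) CR.refl a ⟩
    fromℕ 4 * (a * a)                        ≤⟨ *-monoʳ-≤ (0≤fromℕ 4) (O.trans (*-mono-≤ 0≤a a≤s 0≤a a≤s) ss≤) ⟩
    fromℕ 4 * (fromℕ 2 * (D * u) + p * p)    ≤⟨ *-monoʳ-≤ (0≤fromℕ 4) absorb ⟩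
    fromℕ 4 * ((p + p * p) * fromℕ (suc H))  ≈⟨ CR.*-assoc _ _ _ ⟨
    fromℕ 4 * (p + p * p) * fromℕ (suc H)    ∎
    where
    L a s u p : ℝ
    L = log₂ (fromℕ ν)
    a = half * L
    s = 2^ a
    u = fromℕ (2 ℕ.+ H)
    p = fromℕ 4 * D

    0≤half : 0# ≤ half
    0≤half = *-nonneg 0≤1 (0≤⁻¹ (0<fromℕ {2} (s≤s z≤n)))

    0≤a : 0# ≤ a
    0≤a = *-nonneg 0≤half (0≤log (1≤fromℕ 1≤ν))

    a≤s : a ≤ s
    a≤s = x≤2^x a

    2^L≈ν : 2^ L ≈ fromℕ ν
    2^L≈ν = 2^-log (0<fromℕ 1≤ν)

    log-n : log₂ (fromℕ n) ≤ u + (L + L)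
    log-n = ≤2^⇒log≤ (0<fromℕ 1≤n) (begin
      fromℕ n                                      ≤⟨ fromℕ-mono n≤ ⟩
      fromℕ (2 ℕ.^ (2 ℕ.+ H) ℕ.* (ν ℕ.* ν))
        ≈⟨ CR.trans (fromℕ-* (2 ℕ.^ (2 ℕ.+ H)) _) (CR.*-congˡ (fromℕ-* ν ν)) ⟩
      fromℕ (2 ℕ.^ (2 ℕ.+ H)) * (fromℕ ν * fromℕ ν) ≈⟨ CR.*-cong (2^-fromℕ (2 ℕ.+ H)) (CR.*-cong 2^L≈ν 2^L≈ν) ⟨
      2^ u * (2^ L * 2^ L)                         ≈⟨ CR.*-congˡ (2^-+ L L) ⟨
      2^ u * 2^ (L + L)                            ≈⟨ 2^-+ u (L + L) ⟨
      2^ (u + (L + L))                             ∎)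

    ss≤D : s * s ≤ D * u + p * s
    ss≤D = begin
      s * s                        ≈⟨ CR.trans (2^-half² L) 2^L≈ν ⟩
      fromℕ ν                      ≤⟨ ν≤ ⟩
      D * log₂ (fromℕ n)           ≤⟨ *-monoʳ-≤ 0≤D log-n ⟩
      D * (u + (L + L))            ≈⟨ CR.*-congˡ (CR.+-congˡ (CR.+-cong (halves L) (halves L))) ⟨
      D * (u + (a + a + (a + a)))
        ≈⟨ solve 3 (λ d u a → d :* (u :+ (a :+ a :+ (a :+ a))) := d :* u :+ num 4 :* d :* a) CR.refl D u a ⟩
      D * u + p * a                ≤⟨ +-monoʳ-≤ _ (*-monoʳ-≤ (*-nonneg (0≤fromℕ 4) 0≤D) a≤s) ⟩
      D * u + p * s                ∎

    -- The inequality is doubled first, so that `2ps ≤ p² + s²` returns a single `s * s`, which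
    -- cancels.
    ss≤ : s * s ≤ fromℕ 2 * (D * u) + p * p
    ss≤ = +-cancelʳ-≤ (s * s) (begin
      s * s + s * s                              ≤⟨ +-mono-≤ ss≤D ss≤D ⟩
      D * u + p * s + (D * u + p * s)
        ≈⟨ solve 2 (λ x y → x :+ y :+ (x :+ y) := num 2 :* x :+ (y :+ y)) CR.refl (D * u) (p * s) ⟩
      fromℕ 2 * (D * u) + (p * s + p * s)        ≤⟨ +-monoʳ-≤ _ (xy+xy≤x²+y² p s) ⟩
      fromℕ 2 * (D * u) + (p * p + s * s)        ≈⟨ CR.+-assoc _ _ _ ⟨
      fromℕ 2 * (D * u) + p * p + s * s          ∎)

    u≤ : u ≤ fromℕ 2 * fromℕ (suc H)
    u≤ = begin
      fromℕ (2 ℕ.+ H)            ≤⟨ fromℕ-mono (ℕ.+-monoʳ-≤ 2 (ℕ.m≤m+n H H)) ⟩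
      fromℕ (2 ℕ.+ (H ℕ.+ H))
        ≡⟨ ≡.cong fromℕ (≡.trans (≡.cong suc (≡.sym (ℕ.+-suc H H))) (≡.cong (suc H ℕ.+_) (≡.sym (ℕ.+-identityʳ (suc H))))) ⟩
      fromℕ (2 ℕ.* suc H)        ≈⟨ fromℕ-* 2 (suc H) ⟩
      fromℕ 2 * fromℕ (suc H)    ∎

    -- Since `u` is at most twice `suc H`, the term `2 D u` is at most `4 D = p` times `suc H`.
    absorb : fromℕ 2 * (D * u) + p * p ≤ (p + p * p) * fromℕ (suc H)
    absorb = begin
      fromℕ 2 * (D * u) + p * p
        ≤⟨ +-mono-≤ (*-monoʳ-≤ (0≤fromℕ 2) (*-monoʳ-≤ 0≤D u≤)) pp≤ ⟩
      fromℕ 2 * (D * (fromℕ 2 * fromℕ (suc H))) + p * p * fromℕ (suc H)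
        ≈⟨ solve 2 (λ d h → num 2 :* (d :* (num 2 :* h)) :+ num 4 :* d :* (num 4 :* d) :* h := (num 4 :* d :+ num 4 :* d :* (num 4 :* d)) :* h)
               CR.refl D (fromℕ (suc H)) ⟩
      (p + p * p) * fromℕ (suc H) ∎
      where
      pp≤ : p * p ≤ p * p * fromℕ (suc H)
      pp≤ = O.≤-respˡ-≈ (CR.*-identityʳ _) (*-monoʳ-≤ (0≤x² p) (1≤fromℕ {suc H} (s≤s z≤n)))

-- Assembling the deterministic and the randomized bound.

module TradeOffs (ℛ : Reals) (impl : Implementation) (det : EdgeColoring.DeterministicBase ℛ) where
  open Reals ℛ
  open Probability ℛ
  open EdgeColoring ℛ
  open OrderedField ℛ
  open Likelihood ℛ
  open Recursion ℛ impl
  open Invariants impl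
  open Bounds ℛ
  open ≤-R
  open Algebra.Solver.Ring.NaturalCoefficients.Default CR.commutativeSemiring
    using (solve; _:=_; _:+_; _:*_; con)

  B : ℝ
  B = fromℕ nodeRate

  0≤B : 0# ≤ B
  0≤B = 0≤fromℕ nodeRate

  det-majorant = majorant (proj₁ (DeterministicBase.time det))
  Cᵈ : ℝ
  Cᵈ = proj₁ det-majorant
  0≤Cᵈ : 0# ≤ Cᵈ
  0≤Cᵈ = proj₁ (proj₂ det-majorant)

  det-time : ∀ {N} (G : Graph N) → 1 ℕ.≤ maxDegree G →
             fromℕ (proj₂ (DeterministicBase.run det G)) ≤
             Cᵈ * (fromℕ (size G) * fromℕ (maxDegree G) * log₂ (fromℕ (order G)))
  det-time G 1≤Δ = O.trans (proj₂ (DeterministicBase.time det) G (ℕ.≤-trans 1≤Δ (maxDegree≤size G)))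
    (*-monoˡ-≤ (*-nonneg (*-nonneg (0≤fromℕ (size G)) (0≤fromℕ (maxDegree G))) (0≤log (1≤fromℕ (1≤maxDegree⇒1≤order G 1≤Δ))))
      (proj₂ (proj₂ det-majorant)))

  1≤log : ∀ {n} → 2 ℕ.≤ n → 1# ≤ log₂ (fromℕ n)
  1≤log 2≤n = O.≤-respˡ-≈ fromℕ-1 (2^ℕ≤⇒≤log {1} (fromℕ-mono 2≤n))

  module Deterministic {N₀} (G : Graph N₀) (ε : ℝ) (1≤Δ : 1 ℕ.≤ maxDegree G)
                       (1/Δ≤ε : 1# / fromℕ (maxDegree G) ≤ ε) (ε<1 : ε < 1#) where
    open Depth {3} {maxDegree G} {ε} ℕ.≤-refl (s≤s (s≤s (s≤s z≤n))) 1≤Δ 1/Δ≤ε ε<1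
    m l E A : ℝ
    m = fromℕ (size G)
    l = log₂ (fromℕ (order G))
    E = 1# / ε
    A = fromℕ 10 * Cᵈ * (E * l)

    1≤l : 1# ≤ l
    1≤l = 1≤log (ℕ.≤-trans 2≤Δ (maxDegree≤order G))
    0≤l : 0# ≤ l
    0≤l = O.trans 0≤1 1≤l

    Inv : ∀ {N} → ℕ → Graph N → Set
    Inv h G′ = DegreeBounds 3 (maxDegree G) H h G′ × order G′ ℕ.≤ order G

    1≤Δ′ : ∀ {N} h (G′ : Graph N) → Inv h G′ → 1 ℕ.≤ maxDegree G′
    1≤Δ′ h G′ (bounds , _) = degreeBounds⇒1≤maxDegree ℕ.≤-refl bounds

    nonempty : ∀ {N} h (G′ : Graph N) → Inv h G′ → 1 ℕ.≤ size G′
    nonempty h G′ inv = ℕ.≤-trans (1≤Δ′ h G′ inv) (maxDegree≤size G′)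

    descend : ∀ {N} h (G′ : Graph N) → Inv (suc h) G′ → ∀ b → Inv h (half-graph G′ b)
    descend h G′ (bounds , n′≤n) b =
      degreeBounds-child h G′ bounds b ,
      ℕ.≤-trans (order-part G′ (proj₁ (Implementation.split impl G′)) b) n′≤n

    leaf : ∀ {N} (G′ : Graph N) → Inv 0 G′ → Leaf A G′ (DeterministicBase.run det G′)
    leaf G′ inv@(bounds , n′≤n) = DeterministicBase.proper det G′ , (begin
      fromℕ (proj₂ (DeterministicBase.run det G′))   ≤⟨ det-time G′ 1≤d ⟩
      Cᵈ * (m′ * fromℕ (maxDegree G′) * l′)
        ≤⟨ *-monoʳ-≤ 0≤Cᵈ (*-mono-≤ (*-nonneg 0≤m′ (0≤fromℕ (maxDegree G′)))
                                                          (*-monoʳ-≤ 0≤m′ (leaf-degree (maxDegree G′) (degreeBounds-leaf bounds)))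
                                                          (0≤log (1≤fromℕ 1≤n′)) (log-mono (0<fromℕ 1≤n′) (fromℕ-mono n′≤n))) ⟩
      Cᵈ * (m′ * (fromℕ 10 * E) * l)
        ≈⟨ solve 5 (λ c m t e l → c :* (m :* (t :* e) :* l) := t :* c :* (e :* l) :* m)
             CR.refl Cᵈ m′ (fromℕ 10) E l ⟩
      A * m′                                         ∎)
      where
      m′ l′ : ℝ
      m′ = fromℕ (size G′)
      l′ = log₂ (fromℕ (order G′))
      0≤m′ : 0# ≤ m′
      0≤m′ = 0≤fromℕ (size G′)
      1≤d = 1≤Δ′ 0 G′ inv
      1≤n′ = 1≤maxDegree⇒1≤order G′ 1≤d

    -- The chain `2^H ≤ εΔ ≤ Δ ≤ n` puts the depth below `log n`, so the splitting work fits into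
    -- the leaf bound.
    1+H≤ : fromℕ (suc H) ≤ fromℕ 2 * (E * l)
    1+H≤ = begin
      1# + fromℕ H           ≤⟨ +-mono-≤ 1≤l (H≤log (O.trans εΔ≤Δ (fromℕ-mono (maxDegree≤order G)))) ⟩
      l + l                  ≈⟨ solve 1 (λ l → l :+ l := num 2 :* (con 1 :* l)) CR.refl l ⟩
      fromℕ 2 * (1# * l)     ≤⟨ *-monoʳ-≤ (0≤fromℕ 2) (*-monoˡ-≤ 0≤l 1≤1/ε) ⟩
      fromℕ 2 * (E * l)      ∎

    total-time : rate A H * m ≤ (fromℕ 10 * Cᵈ + fromℕ 2 * B) * (m * l / ε)
    total-time = begin
      (A + fromℕ (suc H) * B) * m
        ≤⟨ *-monoˡ-≤ (0≤fromℕ (size G)) (+-monoʳ-≤ A (*-monoˡ-≤ 0≤B 1+H≤)) ⟩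
      (A + fromℕ 2 * (E * l) * B) * m
        ≈⟨ solve 7 (λ t c w b m l i → (t :* c :* (con 1 :* i :* l) :+ w :* (con 1 :* i :* l) :* b) :* m := (t :* c :+ w :* b) :* (m :* l :* i))
               CR.refl (fromℕ 10) Cᵈ (fromℕ 2) B m l (ε ⁻¹) ⟩
      (fromℕ 10 * Cᵈ + fromℕ 2 * B) * (m * l / ε)  ∎

    T : ℝ
    T = (fromℕ 10 * Cᵈ + fromℕ 2 * B) * (m * l / ε)

    tradeOff : ColorsWithin G ((1# + ε) * fromℕ (maxDegree G)) T (deterministicEdgeColoring impl det H G)
    tradeOff = conclude (deterministicEdgeColoring impl det H G)
      (edgeColoring-good A certainty (λ G′ → Identity.mkIdentity (DeterministicBase.run det G′)) Inv nonempty descend leaf H G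
        (degreeBounds-root q2^H≤Δ+2 , ℕ.≤-refl))
      where
      conclude : ∀ r → Good A H G r → ColorsWithin G ((1# + ε) * fromℕ (maxDegree G)) T r
      conclude (φ , t) (proper , p≤ , t≤) = proper , colors (palette φ) p≤ , O.trans t≤ total-time

  module _ (rnd : RandomizedBase) (c : ℝ) (0<c : 0# < c) where

    rnd-majorant = majorant (proj₁ (RandomizedBase.guarantee rnd))
    Cʳ : ℝ
    Cʳ = proj₁ rnd-majorant
    0≤Cʳ : 0# ≤ Cʳ
    0≤Cʳ = proj₁ (proj₂ rnd-majorant)

    -- `D` is the threshold factor, `F` the constant produced by `log-order²`, and `Z` the 18th
    -- power of the constant in `leaf-degree`. `K` collects deterministic leaves, randomized leaves
    -- and splitting.
    D p F Z K : ℝ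
    D = c + 1#
    p = fromℕ 4 * D
    F = fromℕ 4 * (p + p * p)
    Z = fromℕ 10 ^ 18
    K = Cᵈ * (Z + F) + fromℕ 2 * Cʳ * Z + B

    0≤D : 0# ≤ D
    0≤D = O.trans (proj₁ 0<c) (+-≤ 0≤1)
    0≤p : 0# ≤ p
    0≤p = *-nonneg (0≤fromℕ 4) 0≤D
    0≤F : 0# ≤ F
    0≤F = *-nonneg (0≤fromℕ 4) (O.trans 0≤p (+-≤ (0≤x² p)))
    0≤Z : 0# ≤ Z
    0≤Z = ^-nonneg 18 (0≤fromℕ 10)

    module Randomized {N₀} (G : Graph N₀) (ε : ℝ) (noIso : NoIsolatedVertices G) (1≤Δ : 1 ℕ.≤ maxDegree G)
                      (1/Δ≤ε : 1# / fromℕ (maxDegree G) ≤ ε) (ε<1 : ε < 1#) where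
      open Depth {4} {maxDegree G} {ε} (s≤s (s≤s (s≤s z≤n))) ℕ.≤-refl 1≤Δ 1/Δ≤ε ε<1

      n : ℕ
      n = order G

      m τ δ E E¹⁸ l X A : ℝ
      m   = fromℕ (size G)
      τ   = D * log₂ (fromℕ n)
      -- This is `n^-(c+1)`, the failure allowed to one leaf.
      δ   = 1# / 2^ τ
      E   = 1# / ε
      E¹⁸ = E ^ 18
      l   = log₂ (ε * fromℕ (maxDegree G))
      X   = E¹⁸ + l
      -- A sum, because one leaf rate must cover both kinds of leaf.
      A   = (Cᵈ * (Z + F) + fromℕ 2 * Cʳ * Z) * X

      1≤n : 1 ℕ.≤ n
      1≤n = 1≤maxDegree⇒1≤order G 1≤Δ
      0≤δ : 0# ≤ δ
      0≤δ = *-nonneg 0≤1 (0≤⁻¹ (0<2^ τ))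
      0≤l : 0# ≤ l
      0≤l = 0≤log 1≤εΔ
      E¹⁸≤X : E¹⁸ ≤ X
      E¹⁸≤X = +-≤ 0≤l
      0≤E¹⁸ : 0# ≤ E¹⁸
      0≤E¹⁸ = ^-nonneg 18 (O.trans 0≤1 1≤1/ε)
      0≤X : 0# ≤ X
      0≤X = O.trans 0≤E¹⁸ E¹⁸≤X

      1+H≤X : fromℕ (suc H) ≤ X
      -- The `1` is charged to `ε^-18`, the depth to `log(εΔ)`.
      1+H≤X = +-mono-≤ (1≤^ 18 1≤1/ε) (H≤log O.refl)

      Inv : ∀ {N} → ℕ → Graph N → Set
      Inv h G′ = DegreeBounds 4 (maxDegree G) H h G′ × Spread n H h G′

      2≤Δ′ : ∀ {N} h (G′ : Graph N) → Inv h G′ → 2 ℕ.≤ maxDegree G′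
      2≤Δ′ h G′ (bounds , _) = ℕ.+-cancelʳ-≤ 2 2 _ (degreeBounds⇒maxDegree bounds)

      nonempty : ∀ {N} h (G′ : Graph N) → Inv h G′ → 1 ℕ.≤ size G′
      nonempty h G′ inv = ℕ.≤-trans (ℕ.≤-trans (s≤s z≤n) (2≤Δ′ h G′ inv)) (maxDegree≤size G′)

      descend : ∀ {N} h (G′ : Graph N) → Inv (suc h) G′ → ∀ b → Inv h (half-graph G′ b)
      descend h G′ (bounds , spread) b = degreeBounds-child h G′ bounds b , spread-child h G′ spread b

      module _ {N} (G′ : Graph N) (inv : Inv 0 G′) where
        d n′ : ℕ
        d  = maxDegree G′
        n′ = order G′
        m′ L : ℝ
        m′ = fromℕ (size G′)
        L  = log₂ (fromℕ n′)
        0≤m′ : 0# ≤ m′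
        0≤m′ = 0≤fromℕ (size G′)
        2≤d : 2 ℕ.≤ d
        2≤d = 2≤Δ′ 0 G′ inv
        1≤d : 1 ℕ.≤ d
        1≤d = ℕ.≤-trans (s≤s z≤n) 2≤d
        1≤n′ : 1 ℕ.≤ n′
        1≤n′ = 1≤maxDegree⇒1≤order G′ 1≤d
        0≤Lₙ : 0# ≤ L
        0≤Lₙ = 0≤log (1≤fromℕ 1≤n′)

        d¹⁸≤ : fromℕ d ^ 18 ≤ Z * X
        d¹⁸≤ = begin
          fromℕ d ^ 18           ≤⟨ ^-monoˡ-≤ 18 (0≤fromℕ d) (leaf-degree d (degreeBounds-leaf (proj₁ inv))) ⟩
          (fromℕ 10 * E) ^ 18    ≈⟨ *-^ (fromℕ 10) E 18 ⟩
          Z * E¹⁸                ≤⟨ *-monoʳ-≤ 0≤Z E¹⁸≤X ⟩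
          Z * X                  ∎

        d²≤ : fromℕ d * fromℕ d ≤ Z * X
        d²≤ = begin
          fromℕ d * fromℕ d      ≈⟨ CR.*-congˡ (CR.*-identityʳ _) ⟨
          fromℕ d ^ 2            ≤⟨ ^-monoʳ-≤ (1≤fromℕ 1≤d) {2} {18} (s≤s (s≤s z≤n)) ⟩
          fromℕ d ^ 18           ≤⟨ d¹⁸≤ ⟩
          Z * X                  ∎

        0≤R : 0# ≤ fromℕ 2 * Cʳ * Z
        0≤R = *-nonneg (*-nonneg (0≤fromℕ 2) 0≤Cʳ) 0≤Z

        det-leaf-time : fromℕ n′ ≤ τ → fromℕ (proj₂ (DeterministicBase.run det G′)) ≤ A * m′
        det-leaf-time n′≤τ = begin
          fromℕ (proj₂ (DeterministicBase.run det G′))    ≤⟨ det-time G′ 1≤d ⟩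
          Cᵈ * (m′ * fromℕ d * L)                         ≈⟨ CR.*-congˡ (CR.*-assoc m′ _ L) ⟩
          Cᵈ * (m′ * (fromℕ d * L))                       ≤⟨ *-monoʳ-≤ 0≤Cᵈ (*-monoʳ-≤ 0≤m′ dL≤) ⟩
          Cᵈ * (m′ * (Z * X + F * X))
            ≈⟨ solve 5 (λ c m z f x → c :* (m :* (z :* x :+ f :* x)) := c :* (z :+ f) :* x :* m)
                 CR.refl Cᵈ m′ Z F X ⟩
          Cᵈ * (Z + F) * X * m′                           ≤⟨ *-monoˡ-≤ 0≤m′ (*-monoˡ-≤ 0≤X (+-≤ 0≤R)) ⟩
          A * m′                                          ∎
          where
          dL≤ : fromℕ d * L ≤ Z * X + F * X
          dL≤ = begin
            fromℕ d * L                    ≤⟨ +-≤ (*-nonneg (0≤fromℕ d) 0≤Lₙ) ⟩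
            fromℕ d * L + fromℕ d * L      ≤⟨ xy+xy≤x²+y² (fromℕ d) L ⟩
            fromℕ d * fromℕ d + L * L      ≤⟨ +-mono-≤ d²≤ (log-order² {n} {n′} {H} 0≤D 1≤n 1≤n′
                                                (spread-leaf (proj₂ inv) (nonempty 0 G′ inv)) n′≤τ) ⟩
            Z * X + F * fromℕ (suc H)      ≤⟨ +-monoʳ-≤ _ (*-monoʳ-≤ 0≤F 1+H≤X) ⟩
            Z * X + F * X                  ∎

        -- The subroutine is paid per vertex. Leaves have no isolated vertices, so `n′` is at most
        -- twice the number of edges, whence the factor 2.
        rnd-leaf-time : proj₁ (RandomizedBase.guarantee rnd) * (fromℕ d ^ 18 * fromℕ n′) ≤ A * m′
        rnd-leaf-time = begin
          proj₁ (RandomizedBase.guarantee rnd) * (fromℕ d ^ 18 * fromℕ n′)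
            ≤⟨ *-monoˡ-≤ (*-nonneg (^-nonneg 18 (0≤fromℕ d)) (0≤fromℕ n′)) (proj₂ (proj₂ rnd-majorant)) ⟩
          Cʳ * (fromℕ d ^ 18 * fromℕ n′)
            ≤⟨ *-monoʳ-≤ 0≤Cʳ (*-mono-≤ (^-nonneg 18 (0≤fromℕ d)) d¹⁸≤ (0≤fromℕ n′) (fromℕ-mono (order≤2*size G′ (noIsolated (proj₂ inv))))) ⟩
          Cʳ * (Z * X * fromℕ (2 ℕ.* size G′))
            ≈⟨ CR.*-congˡ (CR.*-congˡ (fromℕ-* 2 (size G′))) ⟩
          Cʳ * (Z * X * (fromℕ 2 * m′))
            ≈⟨ solve 5 (λ c z x t m → c :* (z :* x :* (t :* m)) := t :* c :* z :* x :* m)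
                   CR.refl Cʳ Z X (fromℕ 2) m′ ⟩
          fromℕ 2 * Cʳ * Z * X * m′
            ≤⟨ *-monoˡ-≤ 0≤m′ (*-monoˡ-≤ 0≤X (O.≤-respʳ-≈ (CR.+-comm _ _) (+-≤ (*-nonneg 0≤Cᵈ (O.trans 0≤Z (+-≤ 0≤F)))))) ⟩
          A * m′ ∎

        rnd-leaf-failure : τ ≤ fromℕ n′ → 1# / (fromℕ d ^ n′) ≤ δ
        rnd-leaf-failure τ≤n′ = 1/-anti (0<2^ τ) (begin
          2^ τ                ≤⟨ 2^-mono τ≤n′ ⟩
          2^ (fromℕ n′)       ≈⟨ 2^-fromℕ n′ ⟩
          fromℕ (2 ℕ.^ n′)    ≤⟨ fromℕ-mono (ℕ.^-monoˡ-≤ n′ 2≤d) ⟩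
          fromℕ (d ℕ.^ n′)    ≈⟨ fromℕ-^ d n′ ⟩
          fromℕ d ^ n′        ∎)

        leaf : 1# ≤ Pr (leaf? A G′) (randomizedBase det rnd τ G′) + fromℕ 1 * δ
        leaf with τ ≤? fromℕ n′
        ... | yes τ≤n′ = begin
          1#
            ≤⟨ -≤⇒≤+ (proj₂ (RandomizedBase.guarantee rnd) G′ (nonempty 0 G′ inv)) ⟩
          Pr (withinTime? G′ T) (RandomizedBase.run rnd G′) + 1# / (fromℕ d ^ n′)
            ≤⟨ +-mono-≤ (Pr-⊆ (withinTime? G′ T) (leaf? A G′) (λ { _ (proper , t≤) → proper , O.trans t≤ rnd-leaf-time }) (RandomizedBase.run rnd G′))
                        (rnd-leaf-failure τ≤n′) ⟩
          Pr (leaf? A G′) (RandomizedBase.run rnd G′) + δ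
            ≈⟨ CR.+-congˡ (CR.trans (CR.*-congʳ fromℕ-1) (CR.*-identityˡ δ)) ⟨
          Pr (leaf? A G′) (RandomizedBase.run rnd G′) + fromℕ 1 * δ ∎
          where
          T : ℝ
          T = proj₁ (RandomizedBase.guarantee rnd) * (fromℕ d ^ 18 * fromℕ n′)
        -- A deterministic leaf cannot fail; its unit of failure stays unspent to keep the count
        -- uniform.
        ... | no  τ≰n′ = begin
          1#
            ≈⟨ Pr-return (leaf? A G′) (DeterministicBase.proper det G′ , det-leaf-time n′≤τ) ⟨
          Pr (leaf? A G′) (return (DeterministicBase.run det G′))
            ≤⟨ +-≤ (*-nonneg (0≤fromℕ 1) 0≤δ) ⟩
          Pr (leaf? A G′) (return (DeterministicBase.run det G′)) + fromℕ 1 * δ ∎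
          where
          n′≤τ : fromℕ n′ ≤ τ
          n′≤τ with O.total τ (fromℕ n′)
          ... | inj₁ τ≤n′ = ⊥-elim (τ≰n′ τ≤n′)
          ... | inj₂ n′≤τ = n′≤τ

      total-time : rate A H * m ≤ K * (m * E¹⁸ + m * l)
      total-time = begin
        (A + fromℕ (suc H) * B) * m    ≤⟨ *-monoˡ-≤ (0≤fromℕ (size G)) (+-monoʳ-≤ A (*-monoˡ-≤ 0≤B 1+H≤X)) ⟩
        (A + X * B) * m
          ≈⟨ solve 5 (λ a b m e l → (a :* (e :+ l) :+ (e :+ l) :* b) :* m := (a :+ b) :* (m :* e :+ m :* l))
                 CR.refl (Cᵈ * (Z + F) + fromℕ 2 * Cʳ * Z) B m E¹⁸ l ⟩
        K * (m * E¹⁸ + m * l)          ∎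

      failure : fromℕ (2 ℕ.^ H) * δ ≤ 1# / (fromℕ n ^ʳ c)
      failure = *≤⇒≤/ (0<2^ _) (begin
        fromℕ (2 ℕ.^ H) * δ * nᶜ
          ≈⟨ solve 3 (λ y i w → y :* (con 1 :* i) :* w := w :* y :* i) CR.refl (fromℕ (2 ℕ.^ H)) ((2^ τ) ⁻¹) nᶜ ⟩
        nᶜ * fromℕ (2 ℕ.^ H) / 2^ τ
          -- Cleared of denominators, the claim is `n^c * 2^H ≤ 2^τ`, and `2^τ` is `n^c * n`.
          ≤⟨ ≤*⇒/≤ (0<2^ τ) (begin
               nᶜ * fromℕ (2 ℕ.^ H)
                 ≤⟨ *-monoʳ-≤ (proj₁ (0<2^ _)) (O.trans 2^H≤εΔ (O.trans εΔ≤Δ (fromℕ-mono (maxDegree≤order G)))) ⟩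
               nᶜ * fromℕ n                               ≈⟨ CR.*-congˡ (2^-log (0<fromℕ 1≤n)) ⟨
               nᶜ * 2^ (log₂ (fromℕ n))                   ≈⟨ 2^-+ _ _ ⟨
               2^ (c * log₂ (fromℕ n) + log₂ (fromℕ n))
                 ≈⟨ 2^-cong (solve 2 (λ c l → c :* l :+ l := (c :+ con 1) :* l) CR.refl c (log₂ (fromℕ n))) ⟩
               2^ τ                                       ≈⟨ CR.*-identityˡ _ ⟨
               1# * 2^ τ                                  ∎) ⟩
        1# ∎)
        where
        nᶜ : ℝ
        nᶜ = fromℕ n ^ʳ c

      T : ℝ
      T = K * (m * E¹⁸ + m * l)

      tradeOff : 1# - 1# / (fromℕ n ^ʳ c) ≤
                 Pr (colorsWithin? G ((1# + ε) * fromℕ (maxDegree G)) T) (randomizedEdgeColoring impl det rnd c H G)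
      tradeOff = ≤+⇒-≤ (begin
        1#
          ≤⟨ edgeColoring-good A (likelihood 0≤δ) (randomizedBase det rnd τ) Inv nonempty descend leaf H G
               (degreeBounds-root q2^H≤Δ+2 , spread-root noIso) ⟩
        Pr (good? A H G) result + fromℕ (2 ℕ.^ H) * δ
          ≤⟨ +-mono-≤ (Pr-⊆ (good? A H G) within? conclude result) failure ⟩
        Pr within? result + 1# / (fromℕ n ^ʳ c) ∎)
        where
        result  = randomizedEdgeColoring impl det rnd c H G
        within? = colorsWithin? G ((1# + ε) * fromℕ (maxDegree G)) T
        conclude : ∀ r → Good A H G r → ColorsWithin G ((1# + ε) * fromℕ (maxDegree G)) T r
        conclude (φ , t) (proper , p≤ , t≤) = proper , colors (palette φ) p≤ , O.trans t≤ total-time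

theorem3p11 :
    (ℛ : Reals) →
    let open Reals ℛ
        open Probability ℛ
        open EdgeColoring ℛ
    in
    (impl : Implementation) (det : DeterministicBase) →
    (∃ λ K → ∀ {N} (G : Graph N) (ε : ℝ) →
      let n = fromℕ (order G)
          m = fromℕ (size G)
          Δ = fromℕ (maxDegree G)
          h = depth (ε * Δ / fromℕ 3)
      in
      1 ℕ.≤ maxDegree G → 1# / Δ ≤ ε → ε < 1# →
      ColorsWithin G ((1# + ε) * Δ) (K * (m * log₂ n / ε))
        (deterministicEdgeColoring impl det h G))
    ×
    ((rnd : RandomizedBase) (c : ℝ) → 0# < c →
      ∃ λ K → ∀ {N} (G : Graph N) (ε : ℝ) →
      let n = fromℕ (order G)
          m = fromℕ (size G)
          Δ = fromℕ (maxDegree G)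
          h = depth (ε * Δ / fromℕ 4)
      in
      NoIsolatedVertices G →
      1 ℕ.≤ maxDegree G → log₂ (log₂ n) / log₂ n ≤ ε → 1# / Δ ≤ ε → ε < 1# →
      1# - 1# / (n ^ʳ c) ≤
        Pr (colorsWithin? G ((1# + ε) * Δ) (K * (m * (1# / ε) ^ 18 + m * log₂ (ε * Δ))))
          (randomizedEdgeColoring impl det rnd c h G))
theorem3p11 ℛ impl det =
  -- The constant left to inference is `fromℕ 10 * Cᵈ + fromℕ 2 * B`, which depends on neither `G`
  -- nor `ε`.
  (_ , λ G ε 1≤Δ 1/Δ≤ε ε<1 → Deterministic.tradeOff G ε 1≤Δ 1/Δ≤ε ε<1) ,
  λ rnd c 0<c → K rnd c 0<c , λ G ε noIso 1≤Δ _ 1/Δ≤ε ε<1 → Randomized.tradeOff rnd c 0<c G ε noIso 1≤Δ 1/Δ≤ε ε<1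
  where open TradeOffs ℛ impl det
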